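{- Let $s(n) = \log n / t(n)$ be a function for some non-decreasing unbounded function $t(n)=\omega(1)$. Then there is a reduction $f$ such that, for every instance $\langle C, k\rangle$ of $\mathrm{HwSAT}$, writing $n=|\langle C,k\rangle|$: (1) $f(\langle C, k\rangle) = \langle C_1, k_1\rangle$ for some instance $\langle C_1,k_1\rangle$ of $\mathrm{HwSAT}^{s(n)}$; (2) ${\cal P}_{\rm HwSAT}(C, k) \Longleftrightarrow {\cal P}_{\rm HwSAT}(C_1, k_1 s(n_1))$, where $n_1=|\langle C_1,k_1\rangle|$; (3) $f$ is computable in time $2^{o(k)} n^{O(1)}$; where $k_1 = l(k)$ for some function $l(k)\geq r(k)\,t(2^k)$ and some function $r(k)=\omega(1)$ (the functions $l$ and $r$ do not depend on the instance).
   Context: A parameterized problem is a set of pairs $\langle I,k\rangle\in\Sigma^*\times\mathbb{N}$, where $k$ is the parameter. $|\langle I,k\rangle|$ denotes the size of the instance. Logarithms are base 2. A normalized boolean circuit is a boolean circuit whose gates are arranged in levels of alternating AND and OR gates, where gates at level $i$ receive inputs only from gates at level $i-1$, negation gates appear only as inputs to the first-level gates, and the output gate is an AND gate. The predicate ${\cal P}_{\rm HwSAT}(X,y)$ means: $X$ is a normalized boolean circuit with at most $y$ input variables that is satisfied by some assignment setting exactly one half of its input variables to TRUE. $\mathrm{HwSAT}=\{\langle C,k\rangle : {\cal P}_{\rm HwSAT}(C,k)\}$, with parameter $k$. For a function $s(n)$, the extended problem is $\mathrm{HwSAT}^{s(n)}=\{\langle C,k\rangle : {\cal P}_{\rm HwSAT}(C,k\,s(n))\}$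 with $n=|\langle C,k\rangle|$ and parameter $k$.
   Formalization: It is additionally assumed that t(2^k) is bounded by some u(k) computable in time 2^{o(k)}; without this the claim fails, e.g. for t(n)=2^{2^n}, since l(k) ≥ r(k)t(2^k) is too long to be written in the allowed time; the conclusion itself implies this condition. -}

module Defs where

open import Data.Bool.Base using (Bool; true; false; not; _∧_; _∨_)
open import Data.Empty using (⊥-elim)
open import Data.Fin.Base using (Fin)
open import Data.Fin.Subset using (Subset; ∣_∣)
open import Data.List.Base using (List; []; _∷_; _++_; length; drop; replicate; concatMap)
open import Data.Nat.Base
open import Data.Nat.Binary.Base using (ℕᵇ; zero; 2[1+_]; 1+[2_]; fromℕ)
open import Data.Nat.Properties
open import Data.Nat.Solver using (module +-*-Solver)
open import Data.Product.Base using (Σ-syntax; ∃-syntax; _×_; _,_)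
open import Data.Vec.Base as Vec using (Vec; lookup; _[_]≔_)
open import Relation.Binary.PropositionalEquality
open import Relation.Nullary.Decidable.Core using (yes; no)

------------------------------------------------------------------------
-- Non-negative real numbers

-- x is given by its closed lower cut: `below x a b` says a ≤ b * x, that is
-- a / b ≤ x when b > 0 (and a = 0 when b = 0, by `bounded`).  `closed` says
-- that x is the supremum of its cut: (c a - 1) / (c b) ≤ x for all c > 0
-- implies a / b ≤ x.

record ℝ≥0 : Set₁ where
  field
    below   : ℕ → ℕ → Set
    nonneg  : ∀ b → below 0 b
    mono    : ∀ {a a′ b b′} → a′ ≤ a → b ≤ b′ → below a b → below a′ b′
    expand  : ∀ c {a b} → below a b → below (c * a) (c * b)
    reduce  : ∀ c .{{_ : NonZero c}} {a b} → below (c * a) (c * b) → below a b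
    bounded : ∃[ B ] (∀ {a b} → below a b → a ≤ b * B)
    closed  : ∀ {a b} → (∀ c → below (c * a ∸ 1) (c * b)) → below a b

open ℝ≥0 public

infix 4 _≤ℝ_

_≤ℝ_ : ℝ≥0 → ℝ≥0 → Set
x ≤ℝ y = ∀ {a b} → below x a b → below y a b

Positive : ℝ≥0 → Set
Positive x = ∃[ b ] below x 1 b

record ℝ>0 : Set₁ where
  field
    real     : ℝ≥0
    positive : Positive real

open ℝ>0 public

private
  *-swap : ∀ c a m → c * (a * m) ≡ (c * a) * m
  *-swap c a m = sym (*-assoc c a m)

  closed-≤ : ∀ {a B} → (∀ c → c * a ∸ 1 ≤ c * B) → a ≤ B
  closed-≤ {a} {B} h with a ≤? B
  ... | yes p = p
  ... | no ¬p = ⊥-elim (1+n≰n (≤-trans step (h 2)))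
    where
    open ≤-Reasoning
    step : suc (2 * B) ≤ 2 * a ∸ 1
    step = begin
      suc (2 * B)        ≡⟨⟩
      2 + 2 * B ∸ 1      ≡⟨ cong (_∸ 1) (sym (*-suc 2 B)) ⟩
      2 * suc B ∸ 1      ≤⟨ ∸-monoˡ-≤ 1 (*-monoʳ-≤ 2 (≰⇒> ¬p)) ⟩
      2 * a ∸ 1          ∎

ι : ℕ → ℝ≥0
ι m .below a b = a ≤ b * m
ι m .nonneg b = z≤n
ι m .mono p q r = ≤-trans p (≤-trans r (*-monoˡ-≤ m q))
ι m .expand c {a} {b} p = ≤-trans (*-monoʳ-≤ c p) (≤-reflexive (*-swap c b m))
ι m .reduce c {a} {b} p = *-cancelˡ-≤ c (≤-trans p (≤-reflexive (*-assoc c b m)))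
ι m .bounded = m , λ p → p
ι m .closed {a} {b} h =
  closed-≤ λ c → ≤-trans (h c) (≤-reflexive (*-assoc c b m))

infixr 7 _·_

_·_ : ℕ → ℝ≥0 → ℝ≥0
(k · x) .below a b = below x a (b * k)
(k · x) .nonneg b = nonneg x (b * k)
(k · x) .mono p q = mono x p (*-monoˡ-≤ k q)
(k · x) .expand c {a} {b} p = subst (below x (c * a)) (*-swap c b k) (expand x c p)
(k · x) .reduce c {a} {b} p = reduce x c (subst (below x (c * a)) (*-assoc c b k) p)
(k · x) .bounded with bounded x
... | B , h = k * B , λ {a} {b} p → ≤-trans (h p) (≤-reflexive (*-assoc b k B))
(k · x) .closed {a} {b} h =
  closed x λ c → subst (below x (c * a ∸ 1)) (*-assoc c b k) (h c)

-- a / b ≤ x / y holds iff (a / b) * z ≤ x for every fraction z = p / q ≤ y.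

infixl 7 _÷_

_÷_ : ℝ≥0 → ℝ>0 → ℝ≥0
(x ÷ y) .below a b = ∀ {p q} → below (real y) p q → below x (a * p) (b * q)
(x ÷ y) .nonneg b {p} {q} _ = nonneg x (b * q)
(x ÷ y) .mono le le′ h {p} {q} i = mono x (*-monoˡ-≤ p le) (*-monoˡ-≤ q le′) (h i)
(x ÷ y) .expand c {a} {b} h {p} {q} i =
  subst₂ (below x) (*-swap c a p) (*-swap c b q) (expand x c (h i))
(x ÷ y) .reduce c {a} {b} h {p} {q} i =
  reduce x c (subst₂ (below x) (*-assoc c a p) (*-assoc c b q) (h i))
(x ÷ y) .bounded with bounded x | positive y
... | B , h | q , i = q * B , λ {a} {b} j →
  ≤-trans (≤-reflexive (sym (*-identityʳ a)))
    (≤-trans (h (j i)) (≤-reflexive (*-assoc b q B)))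
(x ÷ y) .closed {a} {b} h {zero} {q} i =
  subst (λ z → below x z (b * q)) (sym (*-zeroʳ a)) (nonneg x (b * q))
(x ÷ y) .closed {a} {b} h {p@(suc _)} {q} i = closed x λ c →
  reduce x p (subst₂ (below x) (num c) (den c) (h (c * p) i))
  where
  open +-*-Solver
  num : ∀ c → ((c * p) * a ∸ 1) * p ≡ p * (c * (a * p) ∸ 1)
  num c = trans (*-comm _ p) (cong (λ z → p * (z ∸ 1))
    (solve 3 (λ c p a → (c :* p) :* a := c :* (a :* p)) refl c p a))
  den : ∀ c → ((c * p) * b) * q ≡ p * (c * (b * q))
  den c = solve 4 (λ c p b q → ((c :* p) :* b) :* q := p :* (c :* (b :* q))) refl c p b q

private
  ^-scale : ∀ x c a → x ^ (c * a) ≡ (x ^ a) ^ c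
  ^-scale x c a = trans (cong (x ^_) (*-comm c a)) (sym (^-*-assoc x a c))

  ^-cancelˡ-≤ : ∀ c .{{_ : NonZero c}} {x y} → x ^ c ≤ y ^ c → x ≤ y
  ^-cancelˡ-≤ c p = ≮⇒≥ λ y<x → <⇒≱ (^-monoˡ-< c y<x) p

  2^-cancel-≤ : ∀ {a b} → 2 ^ a ≤ 2 ^ b → a ≤ b
  2^-cancel-≤ p = ≮⇒≥ λ b<a → <⇒≱ (^-monoʳ-< 2 (s≤s (s≤s z≤n)) b<a) p

  n≤2^n : ∀ n → n ≤ 2 ^ n
  n≤2^n zero    = z≤n
  n≤2^n (suc n) = +-mono-≤ (m^n>0 2 n) (≤-trans (n≤2^n n) (m≤m+n (2 ^ n) 0))

  bernoulli : ∀ N c → N ^ c * (N + c) ≤ suc N ^ c * N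
  bernoulli N zero    = ≤-reflexive (cong (1 *_) (+-identityʳ N))
  bernoulli N (suc c) = begin
    (N * N ^ c) * (N + suc c)           ≤⟨ m≤m+n _ (N ^ c * c) ⟩
    (N * N ^ c) * (N + suc c) + N ^ c * c
      ≡⟨ solve 3 (λ N P c → (N :* P) :* (N :+ (con 1 :+ c)) :+ P :* c
                    := (con 1 :+ N) :* (P :* (N :+ c))) refl N (N ^ c) c ⟩
    suc N * (N ^ c * (N + c))           ≤⟨ *-monoʳ-≤ (suc N) (bernoulli N c) ⟩
    suc N * (suc N ^ c * N)             ≡⟨ *-swap (suc N) (suc N ^ c) N ⟩
    (suc N * suc N ^ c) * N             ∎
    where
    open ≤-Reasoning
    open +-*-Solver

  exceeds-double : ∀ {N M} .{{_ : NonZero N}} → N < M → 2 * N ^ (2 * N) < M ^ (2 * N)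
  exceeds-double {N} {M} N<M = *-cancelʳ-< N (2 * N ^ c) (M ^ c) (begin-strict
    (2 * P) * N      <⟨ m<m+n ((2 * P) * N) (>-nonZero⁻¹ (P * N) {{m*n≢0 P N {{m^n≢0 N c}}}}) ⟩
    (2 * P) * N + P * N
      ≡⟨ solve 2 (λ P N → (con 2 :* P) :* N :+ P :* N := P :* (N :+ con 2 :* N)) refl P N ⟩
    P * (N + c)      ≤⟨ bernoulli N c ⟩
    suc N ^ c * N    ≤⟨ *-monoˡ-≤ N (^-monoˡ-≤ c N<M) ⟩
    M ^ c * N        ∎)
    where
    open ≤-Reasoning
    open +-*-Solver
    c = 2 * N
    P = N ^ c

  2^-pred : ∀ a → 2 ^ a ≤ 2 * 2 ^ (a ∸ 1)
  2^-pred zero    = s≤s z≤n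
  2^-pred (suc a) = ≤-refl

  log-closed : ∀ {M N} .{{_ : NonZero N}} →
               (∀ c → M ^ c ≤ 2 * N ^ c) → M ≤ N
  log-closed {M} {N} h = ≮⇒≥ λ N<M → <⇒≱ (exceeds-double N<M) (h (2 * N))

log₂ : (n : ℕ) .{{_ : NonZero n}} → ℝ≥0
log₂ n .below a b = 2 ^ a ≤ n ^ b
log₂ n .nonneg b = m^n>0 n b
log₂ n .mono p q r = ≤-trans (^-monoʳ-≤ 2 p) (≤-trans r (^-monoʳ-≤ n q))
log₂ n .expand c {a} {b} p =
  subst₂ _≤_ (sym (^-scale 2 c a)) (sym (^-scale n c b)) (^-monoˡ-≤ c p)
log₂ n .reduce c {a} {b} p =
  ^-cancelˡ-≤ c (subst₂ _≤_ (^-scale 2 c a) (^-scale n c b) p)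
log₂ n .bounded = n , λ {a} {b} p → 2^-cancel-≤
  (≤-trans p (≤-trans (^-monoˡ-≤ b (n≤2^n n)) (≤-reflexive
    (trans (^-*-assoc 2 n b) (cong (2 ^_) (*-comm n b))))))
log₂ n .closed {a} {b} h = log-closed {{m^n≢0 n b}} λ c →
  subst₂ _≤_ (^-scale 2 c a) (cong (2 *_) (^-scale n c b))
    (≤-trans (2^-pred (c * a)) (*-monoʳ-≤ 2 (h c)))

------------------------------------------------------------------------
-- Asymptotics

NonDecreasing : (ℕ → ℝ≥0) → Set
NonDecreasing t = ∀ {m n} → m ≤ n → t m ≤ℝ t n

-- t = ω(1)
Is-ω1 : (ℕ → ℝ≥0) → Set
Is-ω1 t = ∀ c → ∃[ N ] (∀ n → N ≤ n → ι c ≤ℝ t n)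

-- g(k) = o(k)
Is-o : (ℕ → ℕ) → Set
Is-o g = ∀ c → ∃[ K ] (∀ k → K ≤ k → c * g k ≤ k)

------------------------------------------------------------------------
-- Normalized circuits

data Gate : Set where
  AND OR : Gate

dual : Gate → Gate
dual AND = OR
dual OR  = AND

-- `Levels g w`: the levels above w wires, the lowest of them consisting of
-- g-gates and the last of them of the output gate alone.  A gate is the set
-- of wires it reads; its fan-in is arbitrary.

data Levels : Gate → ℕ → Set where
  output : ∀ {w} → Subset w → Levels AND w
  level  : ∀ {g w w′} → Vec (Subset w) w′ → Levels (dual g) w′ → Levels g w

-- The first level reads the variables x₀ … xₘ₋₁ followed by their negations.

record Circuit : Set where
  constructor circuit
  field
    inputs    : ℕ
    firstGate : Gate
    levels    : Levels firstGate (inputs + inputs)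

open Circuit public

Assignment : ℕ → Set
Assignment m = Subset m

evalGate : ∀ {w} → Gate → Subset w → Vec Bool w → Bool
evalGate AND S v = Vec.foldr _ _∧_ true  (Vec.zipWith (λ s b → not s ∨ b) S v)
evalGate OR  S v = Vec.foldr _ _∨_ false (Vec.zipWith _∧_ S v)

evalLevels : ∀ {g w} → Levels g w → Vec Bool w → Bool
evalLevels         (output S)   v = evalGate AND S v
evalLevels {g = g} (level Ss L) v = evalLevels L (Vec.map (λ S → evalGate g S v) Ss)

eval : (C : Circuit) → Assignment (inputs C) → Bool
eval C a = evalLevels (levels C) (a Vec.++ Vec.map not a)

-- y is a real, since k * s(n) need not be an integer.
P-HwSAT : Circuit → ℝ≥0 → Set
P-HwSAT X y = ι (inputs X) ≤ℝ y
            × (Σ[ a ∈ Assignment (inputs X) ] (2 * ∣ a ∣ ≡ inputs X × eval X a ≡ true))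

------------------------------------------------------------------------
-- Instances over the alphabet {0,1}

Word : Set
Word = List Bool

unary : ℕ → Word
unary n = replicate n true ++ false ∷ []

-- Adjacency-matrix encoding, level by level.
encodeLevels : ∀ {g w} → Levels g w → Word
encodeLevels (output S)             = false ∷ Vec.toList S
encodeLevels (level {w′ = w′} Ss L) =
  true ∷ unary w′ ++ concatMap Vec.toList (Vec.toList Ss) ++ encodeLevels L

encodeGate : Gate → Bool
encodeGate AND = true
encodeGate OR  = false

encode : Circuit → Word
encode C = unary (inputs C) ++ encodeGate (firstGate C) ∷ encodeLevels (levels C)

-- Bijective binary, least significant digit first; k has ⌊log₂ (k + 1)⌋ digits.
digits : ℕᵇ → Word
digits zero     = []
digits 2[1+ x ] = true ∷ digits x
digits 1+[2 x ] = false ∷ digits x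

binary : ℕ → Word
binary k = digits (fromℕ k)

Instance : Set
Instance = Circuit × ℕ

-- The additional 1 accounts for the separator between C and k.
size : Instance → ℕ
size (C , k) = suc (length (encode C) + length (binary k))

s[_] : (ℕ → ℝ>0) → (n : ℕ) .{{_ : NonZero n}} → ℝ≥0
s[ t ] n = log₂ n ÷ t n

------------------------------------------------------------------------
-- Computability in bounded time

-- Structured programs for a machine with v stacks of bits and unit cost per
-- stack operation and per test.  Up to constant factors in time these are the
-- multi-tape Turing machines: two stacks make a tape, and a tape holds a
-- stack.

Store : ℕ → Set
Store v = Vec Word v

infixr 5 _⨾_

data Prog (v : ℕ) : Set where
  skip  : Prog v
  push  : Fin v → Bool → Prog v
  pop   : Fin v → Prog v
  _⨾_   : Prog v → Prog v → Prog v
  case  : Fin v → Prog v → Prog v → Prog v → Prog v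
  while : Fin v → Prog v → Prog v

infix 4 _⊢_⇓[_]_

-- p ⊢ σ ⇓[ c ] τ : started in σ, p halts in τ after c steps.
data _⊢_⇓[_]_ {v : ℕ} : Prog v → Store v → ℕ → Store v → Set where
  skip       : ∀ {σ} → skip ⊢ σ ⇓[ 1 ] σ
  push       : ∀ {σ x b} → push x b ⊢ σ ⇓[ 1 ] σ [ x ]≔ (b ∷ lookup σ x)
  pop        : ∀ {σ x} → pop x ⊢ σ ⇓[ 1 ] σ [ x ]≔ drop 1 (lookup σ x)
  seq        : ∀ {p q σ ρ τ c d} → p ⊢ σ ⇓[ c ] ρ → q ⊢ ρ ⇓[ d ] τ →
               p ⨾ q ⊢ σ ⇓[ c + d ] τ
  case-empty : ∀ {x p q r σ τ c} → lookup σ x ≡ [] →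
               p ⊢ σ ⇓[ c ] τ → case x p q r ⊢ σ ⇓[ suc c ] τ
  case-false : ∀ {x p q r σ τ c w} → lookup σ x ≡ false ∷ w →
               q ⊢ σ ⇓[ c ] τ → case x p q r ⊢ σ ⇓[ suc c ] τ
  case-true  : ∀ {x p q r σ τ c w} → lookup σ x ≡ true ∷ w →
               r ⊢ σ ⇓[ c ] τ → case x p q r ⊢ σ ⇓[ suc c ] τ
  while-done : ∀ {x p σ} → lookup σ x ≡ [] → while x p ⊢ σ ⇓[ 1 ] σ
  while-step : ∀ {x p σ ρ τ c d b w} → lookup σ x ≡ b ∷ w →
               p ⊢ σ ⇓[ c ] ρ → while x p ⊢ ρ ⇓[ d ] τ →
               while x p ⊢ σ ⇓[ suc (c + d) ] τ

infix 4 _maps_to_within_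

-- The input is in the first a stacks, where the output is left as well; the
-- other w stacks are empty at the start and arbitrary at the end.
_maps_to_within_ : ∀ {a w} → Prog (a + w) → Vec Word a → Vec Word a → ℕ → Set
_maps_to_within_ {a} {w} p xs ys T =
  ∃[ c ] ∃[ zs ] (c ≤ T × p ⊢ xs Vec.++ Vec.replicate w [] ⇓[ c ] ys Vec.++ zs)

encodeInstance : Instance → Vec Word 2
encodeInstance (C , k) = encode C Vec.∷ binary k Vec.∷ Vec.[]

-- f is computable in time 2^o(k) n^O(1).
ReductionTime : (Instance → Instance) → Set
ReductionTime f =
  ∃[ w ] Σ[ p ∈ Prog (2 + w) ] ∃[ g ] ∃[ d ] (Is-o g ×
    (∀ C k → p maps encodeInstance (C , k) to encodeInstance (f (C , k))
               within 2 ^ g k * size (C , k) ^ d))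

-- u is computable in time 2^o(k).
ComputableIn2^o : (ℕ → ℕ) → Set
ComputableIn2^o u =
  ∃[ w ] Σ[ p ∈ Prog (1 + w) ] ∃[ g ] (Is-o g ×
    (∀ k → p maps Vec.[ binary k ] to Vec.[ binary (u k) ] within 2 ^ g k))

-- The usual convention that complexity functions are constructible, in its
-- weakest useful form: a reduction that writes down a parameter l(k) with
-- l(k) ≥ r(k) t(2^k), r = ω(1), in time 2^o(k) n^O(1) yields such a u (run it
-- on a fixed circuit and adjust finitely many values).  If t(n) ≤ log n for
-- n > 1, that is s(n) ≥ 1, then u(k) = k + const works.
Constructible : (ℕ → ℝ≥0) → Set
Constructible t = ∃[ u ] (ComputableIn2^o u × (∀ k → t (2 ^ k) ≤ℝ ι (u k)))

{-# OPTIONS --safe #-}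
module Submission where

-- Let u be the constructible bound on t (2 ^ k) and put l(k) ≥ k · u(k), r(k) = k.
-- An instance with m > k inputs is mapped to a fixed unsatisfiable circuit.
-- Otherwise let n₁ be the size of ⟨C, l(k)⟩ and try at most n₁ - 1 of the 2 ^ m
-- assignments.  If this decides the instance, a fixed circuit without inputs
-- is output.  If not, then n₁ ≤ 2 ^ m ≤ 2 ^ k, so that t(n₁) ≤ u(k) and
-- m ≤ k ≤ l(k) / u(k) ≤ l(k) s(n₁): the circuit itself can be output.

open import Defs
open import Data.Bool.Base using (Bool; true; false; not; _∧_; _∨_; if_then_else_)
open import Data.Bool.Properties using (∧-zeroʳ; ∨-zeroʳ)
open import Data.Empty using (⊥)
open import Data.Fin.Base using (Fin; zero; _↑ˡ_; _↑ʳ_)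
open import Data.Fin.Patterns
open import Data.Fin.Properties using (_≟_)
open import Data.Fin.Subset using (Subset; ∣_∣)
open import Data.List.Base as List
  using ([]; _∷_; _++_; _ʳ++_; length; drop; replicate; reverse; concatMap; null)
open import Data.List.Properties
  using (++-assoc; ++-identityʳ; length-++; length-reverse; length-replicate; length-map; reverse-involutive)
open import Data.Nat.Base
open import Data.Nat.Binary.Base as ℕᵇ using (ℕᵇ; zero; 2[1+_]; 1+[2_]; fromℕ; fromℕ')
open import Data.Nat.Binary.Properties using (fromℕ≡fromℕ'; fromℕ-toℕ; toℕ-fromℕ)
open import Data.Nat.Properties hiding (_≟_)
open import Data.Nat.Solver using (module +-*-Solver)
open import Data.Product.Base using (Σ-syntax; ∃-syntax; _×_; _,_)
open import Data.Sum.Base using (_⊎_; inj₁; inj₂)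
open import Data.Unit.Base using (⊤)
open import Data.Vec.Base as Vec using (Vec; []; _∷_; lookup; _[_]≔_; toList)
open import Data.Vec.Properties
  using (length-toList; toList-++; toList-map; toList-replicate; lookup-++ˡ; lookup-++ʳ;
         []≔-++-↑ˡ; []≔-++-↑ʳ; lookup∘update; lookup∘update′; lookup∘updateAt)
open import Function.Base using (const; _∘_)
open import Function.Bundles using (_⇔_; mk⇔; module Equivalence)
open import Relation.Binary.PropositionalEquality hiding (J)
open import Relation.Nullary.Decidable.Core using (yes; no)
open import Relation.Nullary.Negation using (contradiction)

-- The obstacle is that the bound of the extended problem depends on the output size n₁, which may
-- lie far beyond 2 ^ k. There u(k) says nothing about t(n₁), and l(k) s(n₁) could drop below m. But
-- exactly when n₁ > 2 ^ m the exhaustive search fits into n₁ - 1 tests. Spending this fuel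
-- therefore settles both ranges, without evaluating t or s and without comparing n₁ with a power of
-- two. The factor k in l(k) does double duty: it is the unbounded r(k), and it makes room for the m
-- ≤ k inputs. The factor 2^o(k) in the time has a single source, the computation of u(k). Its
-- number of steps also limits the digits that u(k) adds to n₁, and hence the fuel.

private variable
  v m n : ℕ
  p q : Prog v
  σ ρ τ : Store v

-- Programs on larger stores

rename : (Fin m → Fin n) → Prog m → Prog n
rename r skip           = skip
rename r (push x b)     = push (r x) b
rename r (pop x)        = pop (r x)
rename r (p ⨾ q)        = rename r p ⨾ rename r q
rename r (case x p q s) = case (r x) (rename r p) (rename r q) (rename r s)
rename r (while x p)    = while (r x) (rename r p)

rename-↑ˡ : ∀ {c} (zs : Store n) → p ⊢ σ ⇓[ c ] τ →
            rename (_↑ˡ n) p ⊢ σ Vec.++ zs ⇓[ c ] τ Vec.++ zs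
rename-↑ˡ zs skip = skip
rename-↑ˡ {n = n} {σ = σ} zs (push {x = x} {b}) =
  subst (λ τ → push (x ↑ˡ n) b ⊢ σ Vec.++ zs ⇓[ 1 ] τ)
    (trans (cong (λ w → (σ Vec.++ zs) [ x ↑ˡ n ]≔ (b ∷ w)) (lookup-++ˡ σ zs x)) ([]≔-++-↑ˡ σ zs x))
    push
rename-↑ˡ {n = n} {σ = σ} zs (pop {x = x}) =
  subst (λ τ → pop (x ↑ˡ n) ⊢ σ Vec.++ zs ⇓[ 1 ] τ)
    (trans (cong (λ w → (σ Vec.++ zs) [ x ↑ˡ n ]≔ drop 1 w) (lookup-++ˡ σ zs x)) ([]≔-++-↑ˡ σ zs x))
    pop
rename-↑ˡ zs (seq d e) = seq (rename-↑ˡ zs d) (rename-↑ˡ zs e)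
rename-↑ˡ {σ = σ} zs (case-empty {x = x} eq d) = case-empty (trans (lookup-++ˡ σ zs x) eq) (rename-↑ˡ zs d)
rename-↑ˡ {σ = σ} zs (case-false {x = x} eq d) = case-false (trans (lookup-++ˡ σ zs x) eq) (rename-↑ˡ zs d)
rename-↑ˡ {σ = σ} zs (case-true {x = x} eq d)  = case-true (trans (lookup-++ˡ σ zs x) eq) (rename-↑ˡ zs d)
rename-↑ˡ {σ = σ} zs (while-done {x = x} eq)   = while-done (trans (lookup-++ˡ σ zs x) eq)
rename-↑ˡ {σ = σ} zs (while-step {x = x} eq d e) =
  while-step (trans (lookup-++ˡ σ zs x) eq) (rename-↑ˡ zs d) (rename-↑ˡ zs e)

rename-↑ʳ : ∀ {c} (zs : Store m) → p ⊢ σ ⇓[ c ] τ →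
            rename (m ↑ʳ_) p ⊢ zs Vec.++ σ ⇓[ c ] zs Vec.++ τ
rename-↑ʳ zs skip = skip
rename-↑ʳ {m = m} {σ = σ} zs (push {x = x} {b}) =
  subst (λ τ → push (m ↑ʳ x) b ⊢ zs Vec.++ σ ⇓[ 1 ] τ)
    (trans (cong (λ w → (zs Vec.++ σ) [ m ↑ʳ x ]≔ (b ∷ w)) (lookup-++ʳ zs σ x)) ([]≔-++-↑ʳ zs σ x))
    push
rename-↑ʳ {m = m} {σ = σ} zs (pop {x = x}) =
  subst (λ τ → pop (m ↑ʳ x) ⊢ zs Vec.++ σ ⇓[ 1 ] τ)
    (trans (cong (λ w → (zs Vec.++ σ) [ m ↑ʳ x ]≔ drop 1 w) (lookup-++ʳ zs σ x)) ([]≔-++-↑ʳ zs σ x))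
    pop
rename-↑ʳ zs (seq d e) = seq (rename-↑ʳ zs d) (rename-↑ʳ zs e)
rename-↑ʳ {σ = σ} zs (case-empty {x = x} eq d) = case-empty (trans (lookup-++ʳ zs σ x) eq) (rename-↑ʳ zs d)
rename-↑ʳ {σ = σ} zs (case-false {x = x} eq d) = case-false (trans (lookup-++ʳ zs σ x) eq) (rename-↑ʳ zs d)
rename-↑ʳ {σ = σ} zs (case-true {x = x} eq d)  = case-true (trans (lookup-++ʳ zs σ x) eq) (rename-↑ʳ zs d)
rename-↑ʳ {σ = σ} zs (while-done {x = x} eq)   = while-done (trans (lookup-++ʳ zs σ x) eq)
rename-↑ʳ {σ = σ} zs (while-step {x = x} eq d e) =
  while-step (trans (lookup-++ʳ zs σ x) eq) (rename-↑ʳ zs d) (rename-↑ʳ zs e)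

-- One step pushes at most one bit. For the program computing `u`, this means that the digits of
-- u(k) outnumber those of k by at most the running time, which keeps the search fuel within the
-- time bound.
length-lookup-≤ : ∀ {c} → p ⊢ σ ⇓[ c ] τ → ∀ y →
                  length (lookup τ y) ≤ length (lookup σ y) + c
length-lookup-≤ skip y = m≤m+n _ 1
length-lookup-≤ {σ = σ} (push {x = x} {b}) y with x ≟ y
... | yes refl rewrite lookup∘update x σ (b ∷ lookup σ x) = ≤-reflexive (+-comm 1 _)
... | no x≢y rewrite lookup∘update′ (λ y≡x → x≢y (sym y≡x)) σ (b ∷ lookup σ x) = m≤m+n _ 1
length-lookup-≤ {σ = σ} (pop {x = x}) y with x ≟ y
... | yes refl rewrite lookup∘update x σ (drop 1 (lookup σ x)) =
  ≤-trans (drop-≤ (lookup σ x)) (m≤m+n _ 1)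
  where
  drop-≤ : ∀ w → length (drop 1 w) ≤ length w
  drop-≤ []      = z≤n
  drop-≤ (_ ∷ w) = n≤1+n _
... | no x≢y rewrite lookup∘update′ (λ y≡x → x≢y (sym y≡x)) σ (drop 1 (lookup σ x)) = m≤m+n _ 1
length-lookup-≤ (seq {c = c} {d} e f) y =
  ≤-trans (length-lookup-≤ f y) (≤-trans (+-monoˡ-≤ d (length-lookup-≤ e y)) (≤-reflexive (+-assoc _ c d)))
length-lookup-≤ (case-empty _ e) y = ≤-trans (length-lookup-≤ e y) (+-monoʳ-≤ _ (n≤1+n _))
length-lookup-≤ (case-false _ e) y = ≤-trans (length-lookup-≤ e y) (+-monoʳ-≤ _ (n≤1+n _))
length-lookup-≤ (case-true _ e) y  = ≤-trans (length-lookup-≤ e y) (+-monoʳ-≤ _ (n≤1+n _))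
length-lookup-≤ (while-done _) y   = m≤m+n _ 1
length-lookup-≤ (while-step {c = c} {d} _ e f) y =
  ≤-trans (length-lookup-≤ f y) (≤-trans (+-monoˡ-≤ d (length-lookup-≤ e y))
    (≤-trans (≤-reflexive (+-assoc _ c d)) (+-monoʳ-≤ _ (n≤1+n _))))

-- Cost bounds

-- The cost of p, provided that no loop is iterated more than S times.
bound : ℕ → Prog v → ℕ
bound S skip           = 1
bound S (push x b)     = 1
bound S (pop x)        = 1
bound S (p ⨾ q)        = bound S p + bound S q
bound S (case x p q r) = suc (bound S p + (bound S q + bound S r))
bound S (while x p)    = suc (S * suc (bound S p))

-- The exponent is a crude count relative to the base `2 + S`: the base is at least 2, so one extra
-- factor absorbs an addition, and two factors absorb the iterations of a loop together with their
-- tests.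
degree : Prog v → ℕ
degree skip           = 0
degree (push x b)     = 0
degree (pop x)        = 0
degree (p ⨾ q)        = suc (degree p + degree q)
degree (case x p q r) = suc (suc (degree p + suc (degree q + degree r)))
degree (while x p)    = 2 + degree p

sum-≤-^ : ∀ x a b {y z} → 2 ≤ x → y ≤ x ^ a → z ≤ x ^ b → y + z ≤ x ^ suc (a + b)
sum-≤-^ x a b {y} {z} 2≤x y≤ z≤ = begin
  y + z                         ≤⟨ +-mono-≤ y≤ z≤ ⟩
  x ^ a + x ^ b                 ≤⟨ +-mono-≤ (^-monoʳ-≤ x (m≤m+n a b)) (^-monoʳ-≤ x (m≤n+m b a)) ⟩
  x ^ (a + b) + x ^ (a + b)     ≡⟨ cong (x ^ (a + b) +_) (sym (+-identityʳ _)) ⟩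
  2 * x ^ (a + b)               ≤⟨ *-monoˡ-≤ (x ^ (a + b)) 2≤x ⟩
  x ^ suc (a + b)               ∎
  where
  open ≤-Reasoning
  instance _ = >-nonZero (<-≤-trans (s≤s z≤n) 2≤x)

bound-≤-^ : ∀ S (p : Prog v) → bound S p ≤ (2 + S) ^ degree p
bound-≤-^ S skip           = ≤-refl
bound-≤-^ S (push x b)     = ≤-refl
bound-≤-^ S (pop x)        = ≤-refl
bound-≤-^ S (p ⨾ q)        =
  sum-≤-^ (2 + S) (degree p) (degree q) (s≤s (s≤s z≤n)) (bound-≤-^ S p) (bound-≤-^ S q)
bound-≤-^ S (case x p q r) =
  sum-≤-^ X 0 (suc (degree p + suc (degree q + degree r))) 2≤X ≤-refl
    (sum-≤-^ X (degree p) (suc (degree q + degree r)) 2≤X (bound-≤-^ S p)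
      (sum-≤-^ X (degree q) (degree r) 2≤X (bound-≤-^ S q) (bound-≤-^ S r)))
  where
  X = 2 + S
  2≤X = s≤s (s≤s z≤n)
bound-≤-^ S (while x p)    = begin
  suc (S * suc b)               ≤⟨ +-mono-≤ 1≤y (*-monoʳ-≤ S (+-mono-≤ 1≤y (bound-≤-^ S p))) ⟩
  y + S * (y + y)               ≤⟨ m≤m+n _ (y * (3 + S * (2 + S))) ⟩
  y + S * (y + y) + y * (3 + S * (2 + S))
    ≡⟨ solve 2 (λ y S → y :+ S :* (y :+ y) :+ y :* (con 3 :+ S :* (con 2 :+ S))
                  := (con 2 :+ S) :* ((con 2 :+ S) :* y)) refl y S ⟩
  (2 + S) * ((2 + S) * y)       ∎
  where
  open ≤-Reasoning
  open +-*-Solver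
  b = bound S p
  y = (2 + S) ^ degree p
  1≤y : 1 ≤ y
  1≤y = m^n>0 (2 + S) (degree p)

-- Composing runs of bounded cost

-- A single `S` for all loops makes the cost bound a function of the program text, so runs compose
-- without any bookkeeping of actual costs.
record Run (S : ℕ) (p : Prog v) (σ τ : Store v) : Set where
  constructor run
  field
    {cost} : ℕ
    cost≤  : cost ≤ bound S p
    steps  : p ⊢ σ ⇓[ cost ] τ

data Iter {v} (S : ℕ) (x : Fin v) (p : Prog v) : ℕ → Store v → Store v → Set where
  stop : ∀ {σ} → lookup σ x ≡ [] → Iter S x p 0 σ σ
  next : ∀ {n b w σ ρ τ} → lookup σ x ≡ b ∷ w → Run S p σ ρ → Iter S x p n ρ τ →
         Iter S x p (suc n) σ τ

infixr 4 _⨟_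

_⨟_ : ∀ {S} → Run S p σ ρ → Run S q ρ τ → Run S (p ⨾ q) σ τ
run c≤ d ⨟ run c′≤ d′ = run (+-mono-≤ c≤ c′≤) (seq d d′)

loop : ∀ {S n x} → n ≤ S → Iter S x p n σ τ → Run S (while x p) σ τ
loop {p = p} {S = S} n≤S it with iterate it
  where
  iterate : ∀ {n x σ τ} → Iter S x p n σ τ →
            ∃[ c ] (c ≤ suc (n * suc (bound S p)) × while x p ⊢ σ ⇓[ c ] τ)
  iterate (stop eq) = 1 , ≤-refl , while-done eq
  iterate {suc n} (next eq (run c≤ d) it) with iterate it
  ... | _ , c′≤ , d′ = _ , s≤s (≤-trans (+-mono-≤ c≤ c′≤) (≤-reflexive (+-suc _ _)))
                     , while-step eq d d′
... | _ , c≤ , d = run (≤-trans c≤ (s≤s (*-monoˡ-≤ (suc (bound S p)) n≤S))) d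

branch : ∀ {A : Set} → Word → A → A → A → A
branch []          p q r = p
branch (false ∷ _) p q r = q
branch (true  ∷ _) p q r = r

-- `branch` reduces once the top of the stack is known, so on a concrete store the premise is
-- already a run of the selected arm.
split : ∀ {S x r} → Run S (branch (lookup σ x) p q r) σ τ → Run S (case x p q r) σ τ
split {σ = σ} {p = p} {q = q} {S = S} {x} {r} d with lookup σ x in eq
... | []        with run c≤ d′ ← d = run (s≤s (≤-trans c≤ (m≤m+n _ _))) (case-empty eq d′)
... | false ∷ _ with run c≤ d′ ← d =
  run (s≤s (≤-trans c≤ (≤-trans (m≤m+n (bound S q) _) (m≤n+m _ (bound S p))))) (case-false eq d′)
... | true ∷ _  with run c≤ d′ ← d =
  run (s≤s (≤-trans c≤ (≤-trans (m≤n+m _ (bound S q)) (m≤n+m _ (bound S p))))) (case-true eq d′)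

LoopFree : Prog v → Set
LoopFree skip           = ⊤
LoopFree (push x b)     = ⊤
LoopFree (pop x)        = ⊤
LoopFree (p ⨾ q)        = LoopFree p × LoopFree q
LoopFree (case x p q r) = LoopFree p × LoopFree q × LoopFree r
LoopFree (while x p)    = ⊥

exec : Prog v → Store v → Store v
exec skip           σ = σ
exec (push x b)     σ = σ [ x ]≔ (b ∷ lookup σ x)
exec (pop x)        σ = σ [ x ]≔ drop 1 (lookup σ x)
exec (p ⨾ q)        σ = exec q (exec p σ)
exec (case x p q r) σ = branch (lookup σ x) (exec p σ) (exec q σ) (exec r σ)
exec (while x p)    σ = σ

-- The final store is found by evaluation: on stores listed stack by stack `exec` normalizes, and
-- the witness of loop-freeness, a product of unit types, is inferred.
straight : ∀ {S} {_ : LoopFree p} → Run S p σ (exec p σ)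
straight {p = p} {σ = σ} {S} {ok} = go p ok σ
  where
  go : (p : Prog v) → LoopFree p → (σ : Store v) → Run S p σ (exec p σ)
  go skip           _            σ = run ≤-refl skip
  go (push x b)     _            σ = run ≤-refl push
  go (pop x)        _            σ = run ≤-refl pop
  go (p ⨾ q)        (f , g)      σ = go p f σ ⨟ go q g (exec p σ)
  go (case x p q r) (f , g , h)  σ = split (pick (lookup σ x))
    where
    pick : ∀ w → Run S (branch w p q r) σ (branch w (exec p σ) (exec q σ) (exec r σ))
    pick []          = go p f σ
    pick (false ∷ _) = go q g σ
    pick (true ∷ _)  = go r h σ

-- A loop only knows that its stack is nonempty; the inner test recovers the bit, and its empty arm
-- is never reached.
each : Fin v → (Bool → Prog v) → Prog v
each x p = while x (case x skip (pop x ⨾ p false) (pop x ⨾ p true))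

private variable
  S : ℕ

consume : ∀ {x b w} (p : Bool → Prog v) {σ ρ τ} → lookup σ x ≡ b ∷ w →
          Run S (p b) (σ [ x ]≔ w) ρ →
          Iter S x (case x skip (pop x ⨾ p false) (pop x ⨾ p true)) n ρ τ →
          Iter S x (case x skip (pop x ⨾ p false) (pop x ⨾ p true)) (suc n) σ τ
consume {S = S} {x = x} {b} {w} p {σ} {ρ} eq r it = next eq (split (body b w eq r)) it
  where
  body : ∀ b w → lookup σ x ≡ b ∷ w → Run S (p b) (σ [ x ]≔ w) ρ →
         Run S (branch (lookup σ x) skip (pop x ⨾ p false) (pop x ⨾ p true)) σ ρ
  body b w eq r rewrite eq with b
  ... | false = subst (λ w′ → Run S (pop x) σ (σ [ x ]≔ drop 1 w′)) eq straight ⨟ r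
  ... | true  = subst (λ w′ → Run S (pop x) σ (σ [ x ]≔ drop 1 w′)) eq straight ⨟ r

-- `st w z` is the loop invariant: `w` is still to be read, and `z` holds what has been read, latest
-- bit first. This is why the word ends up reversed.
each-run : ∀ {x} (p : Bool → Prog v) (st : Word → Word → Store v) →
           (∀ {w z} → lookup (st w z) x ≡ w) →
           (∀ b {w z} → Run S (p b) (st (b ∷ w) z [ x ]≔ w) (st w (b ∷ z))) →
           ∀ w {z} → length w ≤ S → Run S (each x p) (st w z) (st [] (w ʳ++ z))
each-run {S = S} {x} p st top body w w≤S = loop w≤S (iterate w)
  where
  iterate : ∀ w {z} → Iter S x _ (length w) (st w z) (st [] (w ʳ++ z))
  iterate []      = stop top
  iterate (b ∷ w) = consume p top (body b) (iterate w)

-- X, K: the instance and then the output.  J: first the parameter counted down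
-- to test m ≤ k, later the current assignment.  Y, Z: the code of the levels and
-- its working copy.  V, W: wire values below and above the current level, whose
-- width and gate are N and G.  B: surplus of true or false inputs.  F: fuel.
-- R: successes.  D: underflows of J.  E: excess of m over k.  A: an all-true
-- assignment.  U: input and output of the program for the bound on t.
-- T, H: scratch.
pattern X = 0F
pattern K = 1F
pattern T = 2F
pattern H = 3F
pattern J = 4F
pattern D = 5F
pattern Z = 6F
pattern V = 7F
pattern W = 8F
pattern N = 9F
pattern G = Fin.suc N
pattern B = Fin.suc G
pattern Y = Fin.suc B
pattern R = Fin.suc Y
pattern F = Fin.suc R
pattern E = Fin.suc F
pattern A = Fin.suc E
pattern U = Fin.suc A

Program : Set
Program = Prog 18

clear : Fin 18 → Program
clear x = each x (const skip)

private variable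
  x k t h j d z w g b y r f e a u i : Word

-- Binary counters, least significant digit first

decrement : Word → Word
decrement []          = []
decrement (true ∷ w)  = false ∷ w
decrement (false ∷ w) = true ∷ decrement w

underflows : Word → Bool
underflows []          = true
underflows (true ∷ w)  = false
underflows (false ∷ w) = underflows w

mark : Bool → Word → Word
mark true  w = true ∷ w
mark false w = w

-- `H` is a flag for the pending borrow. The digits passed were `false` and wait as `true` on `T`
-- until they are put back.
borrow : Program
borrow = case J (push D true ⨾ pop H) (pop J ⨾ push T true) (pop J ⨾ push J false ⨾ pop H)

dec : Program
dec = push H true ⨾ while H borrow ⨾ each T (push J)

dec-run : ∀ j {φ} → length j < S →
          Run S dec (x ∷ k ∷ [] ∷ [] ∷ j ∷ d ∷ φ)
                    (x ∷ k ∷ [] ∷ [] ∷ decrement j ∷ mark (underflows j) d ∷ φ)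
dec-run {S = S} {x} {k} {d} j {φ} j<S =
  let n , t′ , j′ , n≤ , t′≤ , eq , it = scan j [] in
  straight ⨟ loop (≤-trans n≤ j<S) it ⨟
  subst (λ j″ → Run S (each T (push J)) (st t′ j′) (st [] j″)) eq
    (each-run (push J) st refl (λ b → straight) t′ (≤-trans t′≤ (<⇒≤ j<S)))
  where
  st : Word → Word → Store 18
  st t j′ = x ∷ k ∷ t ∷ [] ∷ j′ ∷ mark (underflows j) d ∷ φ

  scan : ∀ j t → ∃[ n ] ∃[ t′ ] ∃[ j′ ]
         ( n ≤ suc (length j) × length t′ ≤ length t + length j × t′ ʳ++ j′ ≡ t ʳ++ decrement j
         × Iter S H borrow n (x ∷ k ∷ t ∷ (true ∷ []) ∷ j ∷ d ∷ φ)
                             (x ∷ k ∷ t′ ∷ [] ∷ j′ ∷ mark (underflows j) d ∷ φ))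
  scan []          t = 1 , t , [] , ≤-refl , m≤m+n _ _ , refl , next refl (split straight) (stop refl)
  scan (true ∷ j)  t = 1 , t , false ∷ j , s≤s z≤n , m≤m+n _ _ , refl , next refl (split straight) (stop refl)
  scan (false ∷ j) t with scan j (true ∷ t)
  ... | n , t′ , j′ , n≤ , t′≤ , eq , it =
    suc n , t′ , j′ , s≤s n≤ , ≤-trans t′≤ (≤-reflexive (sym (+-suc (length t) (length j)))) , eq
    , next refl (split straight) it

-- Evaluation of circuits

-- The top of `W` accumulates the value of the gate. Only the absorbing bit can change it: `true`
-- for OR and `false` for AND.
update : Bool → Program
update true  = case G skip (pop W ⨾ push W true) skip
update false = case G skip skip (pop W ⨾ push W false)

rowStep : Bool → Program
rowStep b = push T b ⨾ case Z skip (pop Z) (pop Z ⨾ update b)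

row : Program
row = case G skip (push W false) (push W true) ⨾ each V rowStep ⨾ each T (push V)

combine : Gate → Bool → Bool → Bool
combine AND = _∧_
combine OR  = _∨_

gate : Gate → Word
gate g = encodeGate g ∷ []

-- The machine accumulates from the left while `evalGate` folds from the right. The two agree
-- because a selected absorbing bit determines the result, whatever `acc` was.
row-iter : ∀ g (P : Subset m) (c : Vec Bool m) {t acc res φ} → res ≡ combine g acc (evalGate g P c) →
           Iter S V (case V skip (pop V ⨾ rowStep false) (pop V ⨾ rowStep true)) m
             (x ∷ k ∷ t ∷ h ∷ j ∷ d ∷ (toList P ++ z) ∷ toList c ∷ (acc ∷ w) ∷ i ∷ gate g ∷ φ)
             (x ∷ k ∷ (toList c ʳ++ t) ∷ h ∷ j ∷ d ∷ z ∷ [] ∷ (res ∷ w) ∷ i ∷ gate g ∷ φ)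
row-iter AND [] [] {acc = true}  refl = stop refl
row-iter AND [] [] {acc = false} refl = stop refl
row-iter OR  [] [] {acc = true}  refl = stop refl
row-iter OR  [] [] {acc = false} refl = stop refl
row-iter AND (false ∷ P) (false ∷ c) eq = consume rowStep refl straight (row-iter AND P c eq)
row-iter AND (false ∷ P) (true ∷ c)  eq = consume rowStep refl straight (row-iter AND P c eq)
row-iter AND (true ∷ P)  (true ∷ c)  eq = consume rowStep refl straight (row-iter AND P c eq)
row-iter AND (true ∷ P)  (false ∷ c) {acc = acc} eq =
  consume rowStep refl straight (row-iter AND P c (trans eq (∧-zeroʳ acc)))
row-iter OR  (false ∷ P) (false ∷ c) eq = consume rowStep refl straight (row-iter OR P c eq)
row-iter OR  (false ∷ P) (true ∷ c)  eq = consume rowStep refl straight (row-iter OR P c eq)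
row-iter OR  (true ∷ P)  (false ∷ c) eq = consume rowStep refl straight (row-iter OR P c eq)
row-iter OR  (true ∷ P)  (true ∷ c)  {acc = acc} eq =
  consume rowStep refl straight (row-iter OR P c (trans eq (∨-zeroʳ acc)))

row-run : ∀ g (P : Subset m) (c : Vec Bool m) {φ} → m ≤ S →
          Run S row
            (x ∷ k ∷ [] ∷ h ∷ j ∷ d ∷ (toList P ++ z) ∷ toList c ∷ w ∷ i ∷ gate g ∷ φ)
            (x ∷ k ∷ [] ∷ h ∷ j ∷ d ∷ z ∷ toList c ∷ (evalGate g P c ∷ w) ∷ i ∷ gate g ∷ φ)
row-run {S = S} {x} {k} {h} {j} {d} {z} {w} {i} g P c {φ} m≤S =
  init g ⨟ loop m≤S (row-iter g P c (unit g)) ⨟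
  subst (λ c′ → Run S (each T (push V)) (st (reverse (toList c)) []) (st [] c′)) (reverse-involutive (toList c))
    (each-run (push V) st refl (λ b → straight) (reverse (toList c))
      (≤-trans (≤-reflexive (trans (length-reverse (toList c)) (length-toList c))) m≤S))
  where
  st : Word → Word → Store 18
  st t c′ = x ∷ k ∷ t ∷ h ∷ j ∷ d ∷ z ∷ c′ ∷ (evalGate g P c ∷ w) ∷ i ∷ gate g ∷ φ

  init : ∀ g {z c} → Run S (case G skip (push W false) (push W true))
           (x ∷ k ∷ t ∷ h ∷ j ∷ d ∷ z ∷ c ∷ w ∷ i ∷ gate g ∷ φ)
           (x ∷ k ∷ t ∷ h ∷ j ∷ d ∷ z ∷ c ∷ (encodeGate g ∷ w) ∷ i ∷ gate g ∷ φ)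
  init AND = straight
  init OR  = straight

  unit : ∀ g {b} → b ≡ combine g (encodeGate g) b
  unit AND = refl
  unit OR  = refl

rows-iter : ∀ g (Ps : Vec (Subset m) n) (c : Vec Bool m) i {w φ} → length i ≡ n → m ≤ S →
            Iter S N (case N skip (pop N ⨾ row) (pop N ⨾ row)) n
              (x ∷ k ∷ [] ∷ h ∷ j ∷ d ∷ (concatMap toList (toList Ps) ++ z) ∷ toList c ∷ w ∷ i ∷ gate g ∷ φ)
              (x ∷ k ∷ [] ∷ h ∷ j ∷ d ∷ z ∷ toList c
                ∷ (toList (Vec.map (λ P → evalGate g P c) Ps) ʳ++ w) ∷ [] ∷ gate g ∷ φ)
rows-iter g [] c [] eq m≤S = stop refl
rows-iter {z = z} g (P ∷ Ps) c (b ∷ i) eq m≤S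
  rewrite ++-assoc (toList P) (concatMap toList (toList Ps)) z =
  consume (const row) refl (row-run g P c m≤S) (rows-iter g Ps c i (suc-injective eq) m≤S)

readStep : Program
readStep = case Z skip (pop Z ⨾ pop T) (pop Z ⨾ push N true)

readWidth : Program
readWidth = push T true ⨾ while T readStep

readWidth-run : ∀ m {c} {φ} → m < S →
  Run S readWidth (x ∷ k ∷ [] ∷ h ∷ j ∷ d ∷ (unary m ++ z) ∷ c ∷ w ∷ i ∷ φ)
                  (x ∷ k ∷ [] ∷ h ∷ j ∷ d ∷ z ∷ c ∷ w ∷ (replicate m true ʳ++ i) ∷ φ)
readWidth-run m m<S = straight ⨟ loop m<S (iterate m)
  where
  iterate : ∀ m {c} {φ} → Iter S T readStep (suc m)
    (x ∷ k ∷ (true ∷ []) ∷ h ∷ j ∷ d ∷ (unary m ++ z) ∷ c ∷ w ∷ i ∷ φ)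
    (x ∷ k ∷ [] ∷ h ∷ j ∷ d ∷ z ∷ c ∷ w ∷ (replicate m true ʳ++ i) ∷ φ)
  iterate zero    = next refl (split straight) (stop refl)
  iterate (suc m) = next refl (split straight) (iterate m)

-- The rows leave their values on `W` in reverse order; moving them to `V` restores the order in
-- which the next level reads its wires. `H` stays raised until the output gate is done.
levelStep : Program
levelStep = case Z skip
  (pop Z ⨾ row ⨾ clear V ⨾ pop G ⨾ pop H)
  (pop Z ⨾ readWidth ⨾ each N (const row) ⨾ clear V ⨾ each W (push V) ⨾
   case G skip (pop G ⨾ push G true) (pop G ⨾ push G false))

length-unary : ∀ m → length (unary m) ≡ suc m
length-unary zero    = refl
length-unary (suc m) = cong suc (length-unary m)

-- Since widths are written in unary and every level spends at least one bit, the length of the code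
-- bounds both the widths and the number of levels, hence all loops of the evaluation.
level-length : ∀ {g} (Ps : Vec (Subset m) n) (L : Levels (dual g) n) →
  let rest = unary n ++ concatMap toList (toList Ps) ++ encodeLevels L
  in n < length rest × length (encodeLevels L) ≤ length rest
level-length {n = n} Ps L
  rewrite length-++ (unary n) {concatMap toList (toList Ps) ++ encodeLevels L}
        | length-++ (concatMap toList (toList Ps)) {encodeLevels L}
        | length-unary n = m≤m+n (suc n) _ , ≤-trans (m≤n+m _ _) (m≤n+m _ (suc n))

levels-iter : ∀ {g} (L : Levels g m) (c : Vec Bool m) {φ} → length (encodeLevels L) ≤ S → m ≤ S →
  ∃[ n ] (n ≤ length (encodeLevels L) × Iter S H levelStep n
    (x ∷ k ∷ [] ∷ (true ∷ []) ∷ j ∷ d ∷ encodeLevels L ∷ toList c ∷ [] ∷ [] ∷ gate g ∷ φ)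
    (x ∷ k ∷ [] ∷ [] ∷ j ∷ d ∷ [] ∷ [] ∷ (evalLevels L c ∷ []) ∷ [] ∷ [] ∷ φ))
levels-iter {S = S} {x = x} {k = k} {j = j} {d = d} (output P) c {φ} L≤S m≤S =
  1 , s≤s z≤n , next refl (split (straight
    ⨟ subst (λ z → Run S row (x ∷ k ∷ [] ∷ (true ∷ []) ∷ j ∷ d ∷ z ∷ toList c ∷ [] ∷ [] ∷ gate AND ∷ φ)
        (x ∷ k ∷ [] ∷ (true ∷ []) ∷ j ∷ d ∷ [] ∷ toList c ∷ (evalGate AND P c ∷ []) ∷ [] ∷ gate AND ∷ φ))
        (++-identityʳ (toList P)) (row-run AND P c m≤S)
    ⨟ each-run (const skip)
        (λ c′ _ → x ∷ k ∷ [] ∷ (true ∷ []) ∷ j ∷ d ∷ [] ∷ c′ ∷ (evalGate AND P c ∷ []) ∷ [] ∷ gate AND ∷ φ)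
        refl (λ b → straight) (toList c)
        {[]} (≤-trans (≤-reflexive (length-toList c)) m≤S)
    ⨟ straight)) (stop refl)
levels-iter {S = S} {x = x} {k = k} {j = j} {d = d} (level {g} {m} {n} Ps L) c {φ} L≤S m≤S
  with w≤ , rest≤ ← level-length Ps L
  with n<S ← ≤-trans w≤ (<⇒≤ L≤S)
  with l , l≤ , it ← levels-iter L (Vec.map (λ P → evalGate g P c) Ps) {φ} (≤-trans rest≤ (<⇒≤ L≤S)) (<⇒≤ n<S)
  = suc l , s≤s (≤-trans l≤ rest≤) , next refl (split (straight
    ⨟ readWidth-run n n<S
    ⨟ loop (<⇒≤ n<S) (rows-iter g Ps c (reverse (replicate n true))
        (trans (length-reverse (replicate n true)) (length-replicate n)) m≤S)
    ⨟ each-run (const skip) (λ c _ → st c (reverse values)) refl (λ b → straight) (toList c)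
        {[]} (≤-trans (≤-reflexive (length-toList c)) m≤S)
    ⨟ each-run (push V) (λ w c → st c w) refl (λ b → straight) (reverse values)
        (≤-trans (≤-reflexive (trans (length-reverse values) (length-toList (Vec.map (λ P → evalGate g P c) Ps))))
          (<⇒≤ n<S))
    ⨟ toggle g))
    (subst (λ c → Iter S H levelStep l
        (x ∷ k ∷ [] ∷ (true ∷ []) ∷ j ∷ d ∷ encodeLevels L ∷ c ∷ [] ∷ [] ∷ gate (dual g) ∷ φ) final)
      (sym (reverse-involutive values)) it)
  where
  values = toList (Vec.map (λ P → evalGate g P c) Ps)

  st : Word → Word → Store 18
  st c w = x ∷ k ∷ [] ∷ (true ∷ []) ∷ j ∷ d ∷ encodeLevels L ∷ c ∷ w ∷ [] ∷ gate g ∷ φ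

  final : Store 18
  final =
    x ∷ k ∷ [] ∷ [] ∷ j ∷ d ∷ [] ∷ [] ∷ (evalLevels L (Vec.map (λ P → evalGate g P c) Ps) ∷ []) ∷ [] ∷ [] ∷ φ

  toggle : ∀ g {c z} → Run S (case G skip (pop G ⨾ push G true) (pop G ⨾ push G false))
           (x ∷ k ∷ t ∷ h ∷ j ∷ d ∷ z ∷ c ∷ w ∷ i ∷ gate g ∷ φ)
           (x ∷ k ∷ t ∷ h ∷ j ∷ d ∷ z ∷ c ∷ w ∷ i ∷ gate (dual g) ∷ φ)
  toggle AND = straight
  toggle OR  = straight

-- Testing one assignment

-- The detour through `T` reverses the word a second time, so copies keep the original order.
pass : Fin 18 → (Bool → Program) → Program
pass x p = each x (push T) ⨾ each T p

-- `st t z` has `t` on `T` and shows the effect of `p` on the processed word `z`. As `p` often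
-- writes to `x` itself, the first loop is described by overwriting `x` in a store where it is
-- empty.
pass-run : ∀ {x} (p : Bool → Program) (st : Word → Word → Store 18) →
           (∀ {t} → st t [] [ x ]≔ [] ≡ st t []) →
           (∀ b {w t} → Run S (push T b) ((st t [] [ x ]≔ (b ∷ w)) [ x ]≔ w) (st (b ∷ t) [] [ x ]≔ w)) →
           (∀ {t z} → lookup (st t z) T ≡ t) →
           (∀ b {t z} → Run S (p b) (st (b ∷ t) z [ T ]≔ t) (st t (b ∷ z))) →
           ∀ w → length w ≤ S → Run S (pass x p) (st [] [] [ x ]≔ w) (st [] w)
pass-run {S = S} {x} p st empty move top body w w≤S =
  subst (Run S (each x (push T)) (st [] [] [ x ]≔ w)) empty
    (each-run (push T) (λ w t → st t [] [ x ]≔ w) (λ {_} {t} → lookup∘updateAt x (st t [])) move w w≤S)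
  ⨟ subst (λ z → Run S (each T p) (st (reverse w) []) (st [] z)) (reverse-involutive w)
    (each-run p st top body (reverse w) (≤-trans (≤-reflexive (length-reverse w)) w≤S))

-- |#true - #false| copies of the more frequent bit, once `imbalance` has folded
-- it over a word.
tally : Bool → Word → Word
tally b     []          = b ∷ []
tally false (false ∷ w) = false ∷ false ∷ w
tally true  (false ∷ w) = w
tally false (true ∷ w)  = w
tally true  (true ∷ w)  = true ∷ true ∷ w

imbalance : Word → Word
imbalance = List.foldr tally []

length-imbalance : ∀ w → length (imbalance w) ≤ length w
length-imbalance []      = z≤n
length-imbalance (b ∷ w) = ≤-trans (length-tally b (imbalance w)) (s≤s (length-imbalance w))
  where
  length-tally : ∀ b w → length (tally b w) ≤ suc (length w)
  length-tally b     []          = ≤-refl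
  length-tally false (false ∷ w) = ≤-refl
  length-tally true  (false ∷ w) = m≤n+m _ 2
  length-tally false (true ∷ w)  = m≤n+m _ 2
  length-tally true  (true ∷ w)  = ≤-refl

count : Bool → Program
count false = case B (push B false) (push B false) (pop B)
count true  = case B (push B true) (pop B) (push B true)

count-run : ∀ c b {φ} → Run S (count c)
  (x ∷ k ∷ t ∷ h ∷ j ∷ d ∷ z ∷ i ∷ w ∷ y ∷ g ∷ b ∷ φ)
  (x ∷ k ∷ t ∷ h ∷ j ∷ d ∷ z ∷ i ∷ w ∷ y ∷ g ∷ tally c b ∷ φ)
count-run false []          = straight
count-run false (false ∷ b) = straight
count-run false (true ∷ b)  = straight
count-run true  []          = straight
count-run true  (false ∷ b) = straight
count-run true  (true ∷ b)  = straight

-- The negated bits go onto `V` before the bits themselves, because what is pushed later comes to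
-- stand in front.
evaluate : Program
evaluate =
  pass J (λ b → push J b ⨾ push V (not b)) ⨾
  pass J (λ b → push J b ⨾ push V b ⨾ count b) ⨾
  pass Y (λ b → push Y b ⨾ push Z b) ⨾
  case Z skip (pop Z ⨾ push G false) (pop Z ⨾ push G true) ⨾
  push H true ⨾ while H levelStep ⨾
  case B (case W skip (pop W) (pop W ⨾ push R true)) (pop W) (pop W) ⨾
  clear B

accepts : ∀ {g} → Levels g (m + m) → Vec Bool m → Bool
accepts L a = null (imbalance (toList a)) ∧ evalLevels L (a Vec.++ Vec.map not a)

evaluate-run : ∀ {g} (L : Levels g (m + m)) (a : Vec Bool m) {φ} →
  length (encodeGate g ∷ encodeLevels L) ≤ S → m + m ≤ S →
  Run S evaluate
    (x ∷ k ∷ [] ∷ [] ∷ toList a ∷ d ∷ [] ∷ [] ∷ [] ∷ [] ∷ [] ∷ [] ∷ (encodeGate g ∷ encodeLevels L) ∷ r ∷ φ)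
    (x ∷ k ∷ [] ∷ [] ∷ toList a ∷ d ∷ [] ∷ [] ∷ [] ∷ [] ∷ [] ∷ [] ∷ (encodeGate g ∷ encodeLevels L)
      ∷ mark (accepts L a) r ∷ φ)
evaluate-run {m = m} {S = S} {x} {k} {d} {r} {g} L a {φ} y≤S m+m≤S =
  let l , l≤ , it = levels-iter {S = S} {x = x} {k = k} {j = as} {d = d} L (a Vec.++ Vec.map not a)
                      {δ ∷ ys ∷ r ∷ φ} (<⇒≤ y≤S) m+m≤S in
  pass-run (λ b → push J b ⨾ push V (not b))
    (λ t w → x ∷ k ∷ t ∷ [] ∷ w ∷ d ∷ [] ∷ List.map not w ∷ [] ∷ [] ∷ [] ∷ [] ∷ ys ∷ r ∷ φ)
    refl (λ b → straight) refl (λ b → straight) as j≤S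
  ⨟ pass-run (λ b → push J b ⨾ push V b ⨾ count b)
    (λ t w → x ∷ k ∷ t ∷ [] ∷ w ∷ d ∷ [] ∷ (w ++ List.map not as) ∷ [] ∷ [] ∷ [] ∷ imbalance w ∷ ys ∷ r ∷ φ)
    refl (λ b → straight) refl (λ b {_} {w} → straight ⨟ straight ⨟ count-run b (imbalance w)) as j≤S
  ⨟ pass-run (λ b → push Y b ⨾ push Z b)
    (λ t w → x ∷ k ∷ t ∷ [] ∷ as ∷ d ∷ w ∷ (as ++ List.map not as) ∷ [] ∷ [] ∷ [] ∷ δ ∷ w ∷ r ∷ φ)
    refl (λ b → straight) refl (λ b → straight) ys y≤S
  ⨟ init g
  ⨟ straight
  ⨟ subst (λ c → Run S (while H levelStep)
        (x ∷ k ∷ [] ∷ (true ∷ []) ∷ as ∷ d ∷ encodeLevels L ∷ c ∷ [] ∷ [] ∷ gate g ∷ δ ∷ ys ∷ r ∷ φ)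
        (x ∷ k ∷ [] ∷ [] ∷ as ∷ d ∷ [] ∷ [] ∷ (value ∷ []) ∷ [] ∷ [] ∷ δ ∷ ys ∷ r ∷ φ))
      (trans (toList-++ a (Vec.map not a)) (cong (as ++_) (toList-map not a)))
      (loop (≤-trans l≤ (<⇒≤ y≤S)) it)
  ⨟ verdict δ value
  ⨟ each-run (const skip)
      (λ δ _ → x ∷ k ∷ [] ∷ [] ∷ as ∷ d ∷ [] ∷ [] ∷ [] ∷ [] ∷ [] ∷ δ ∷ ys ∷ mark (accepts L a) r ∷ φ)
      refl (λ b → straight) δ {[]} (≤-trans (length-imbalance as) j≤S)
  where
  as = toList a
  ys = encodeGate g ∷ encodeLevels L
  δ = imbalance as
  value = evalLevels L (a Vec.++ Vec.map not a)

  j≤S : length as ≤ S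
  j≤S = ≤-trans (≤-reflexive (length-toList a)) (≤-trans (m≤m+n m m) m+m≤S)

  init : ∀ g {t z w} → Run S (case Z skip (pop Z ⨾ push G false) (pop Z ⨾ push G true))
    (x ∷ k ∷ t ∷ h ∷ as ∷ d ∷ (encodeGate g ∷ z) ∷ w ∷ [] ∷ [] ∷ [] ∷ δ ∷ ys ∷ r ∷ φ)
    (x ∷ k ∷ t ∷ h ∷ as ∷ d ∷ z ∷ w ∷ [] ∷ [] ∷ gate g ∷ δ ∷ ys ∷ r ∷ φ)
  init AND = straight
  init OR  = straight

  verdict : ∀ b c → Run S (case B (case W skip (pop W) (pop W ⨾ push R true)) (pop W) (pop W))
    (x ∷ k ∷ [] ∷ [] ∷ as ∷ d ∷ [] ∷ [] ∷ (c ∷ []) ∷ [] ∷ [] ∷ b ∷ ys ∷ r ∷ φ)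
    (x ∷ k ∷ [] ∷ [] ∷ as ∷ d ∷ [] ∷ [] ∷ [] ∷ [] ∷ [] ∷ b ∷ ys ∷ mark (null b ∧ c) r ∷ φ)
  verdict []          false = straight
  verdict []          true  = straight
  verdict (false ∷ b) c     = straight
  verdict (true ∷ b)  c     = straight

-- Exhaustive search

previous : Vec Bool m → Vec Bool m
previous []          = []
previous (true ∷ a)  = false ∷ a
previous (false ∷ a) = true ∷ previous a

toList-previous : (a : Vec Bool m) → decrement (toList a) ≡ toList (previous a)
toList-previous []          = refl
toList-previous (true ∷ a)  = refl
toList-previous (false ∷ a) = cong (true ∷_) (toList-previous a)

allFalse : Vec Bool m → Bool
allFalse = underflows ∘ toList

-- Assignments are tried in decreasing binary order, starting over after the
-- last one; `hits` and `wraps` record successes and restarts.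
hits : (Vec Bool m → Bool) → ℕ → Vec Bool m → Word → Word
hits ok zero    a r = r
hits ok (suc n) a r = hits ok n (previous a) (mark (ok a) r)

wraps : ℕ → Vec Bool m → Word → Word
wraps zero    a d = d
wraps (suc n) a d = wraps n (previous a) (mark (allFalse a) d)

search : Program
search = each F (const (evaluate ⨾ dec))

search-run : ∀ {g} (L : Levels g (m + m)) f (a : Vec Bool m) {φ} →
  length (encodeGate g ∷ encodeLevels L) ≤ S → m + m ≤ S → m < S → length f ≤ S →
  ∃[ j ] Run S search
    (x ∷ k ∷ [] ∷ [] ∷ toList a ∷ d ∷ [] ∷ [] ∷ [] ∷ [] ∷ [] ∷ [] ∷ (encodeGate g ∷ encodeLevels L) ∷ r ∷ f ∷ φ)
    (x ∷ k ∷ [] ∷ [] ∷ j ∷ wraps (length f) a d ∷ [] ∷ [] ∷ [] ∷ [] ∷ [] ∷ [] ∷ (encodeGate g ∷ encodeLevels L)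
      ∷ hits (accepts L) (length f) a r ∷ [] ∷ φ)
search-run {m = m} {S = S} {x} {k} {g = g} L f a {φ} y≤S m+m≤S m<S f≤S =
  let j , it = iterate f a refl in j , loop f≤S it
  where
  iterate : ∀ f (a : Vec Bool m) {i d r} → i ≡ toList a → ∃[ j ] Iter S F _ (length f)
    (x ∷ k ∷ [] ∷ [] ∷ i ∷ d ∷ [] ∷ [] ∷ [] ∷ [] ∷ [] ∷ [] ∷ (encodeGate g ∷ encodeLevels L) ∷ r ∷ f ∷ φ)
    (x ∷ k ∷ [] ∷ [] ∷ j ∷ wraps (length f) a d ∷ [] ∷ [] ∷ [] ∷ [] ∷ [] ∷ [] ∷ (encodeGate g ∷ encodeLevels L)
      ∷ hits (accepts L) (length f) a r ∷ [] ∷ φ)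
  iterate []      a refl = toList a , stop refl
  iterate (b ∷ f) a refl with j , it ← iterate f (previous a) (toList-previous a) =
    j , consume (const (evaluate ⨾ dec)) refl
      (evaluate-run L a y≤S m+m≤S
       ⨟ dec-run (toList a) (≤-trans (s≤s (≤-reflexive (length-toList a))) m<S))
      it

-- The reduction program

-- A borrow turns the digit 1 (`false`) into the digit 2 (`true`), so the fixed-length `decrement`
-- also serves bijective numerals. On underflow one digit is too many; all digits are then `true`,
-- so dropping the least significant one is as good as dropping the most significant one.
predecessor : Word → Word
predecessor w = if underflows w then drop 1 (decrement w) else decrement w

predecessor-digits-suc : ∀ x → predecessor (digits (ℕᵇ.suc x)) ≡ digits x
predecessor-digits-suc zero          = refl
predecessor-digits-suc 1+[2 x ]      = refl
predecessor-digits-suc 2[1+ zero ]   = refl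
predecessor-digits-suc 2[1+ 1+[2 x ] ] = refl
predecessor-digits-suc 2[1+ 2[1+ x ] ] with underflows (digits (ℕᵇ.suc x)) | predecessor-digits-suc 2[1+ x ]
... | true  | eq = cong (true ∷_) eq
... | false | eq = cong (true ∷_) eq

binary-suc : ∀ k → ∃[ b ] ∃[ w ] (binary (suc k) ≡ b ∷ w × predecessor (b ∷ w) ≡ binary k)
binary-suc k rewrite fromℕ≡fromℕ' (suc k) | fromℕ≡fromℕ' k
  with fromℕ' k | predecessor-digits-suc (fromℕ' k)
... | zero     | eq = _ , _ , refl , eq
... | 2[1+ _ ] | eq = _ , _ , refl , eq
... | 1+[2 _ ] | eq = _ , _ , refl , eq

length-predecessor : ∀ w → length (predecessor w) ≤ length w
length-predecessor w = helper (underflows w) (decrement w) (≤-reflexive (length-decrement w))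
  where
  length-decrement : ∀ w → length (decrement w) ≡ length w
  length-decrement []          = refl
  length-decrement (true ∷ w)  = refl
  length-decrement (false ∷ w) = cong suc (length-decrement w)

  helper : ∀ b w {n} → length w ≤ n → length (if b then drop 1 w else w) ≤ n
  helper false w       le = le
  helper true  []      le = le
  helper true  (_ ∷ w) le = <⇒≤ le

predJ : Program
predJ = dec ⨾ case D skip (pop D) (pop D ⨾ pop J)

predJ-run : ∀ j {φ} → length j < S →
            Run S predJ (x ∷ k ∷ [] ∷ [] ∷ j ∷ [] ∷ φ) (x ∷ k ∷ [] ∷ [] ∷ predecessor j ∷ [] ∷ φ)
predJ-run {S = S} {x} {k} j {φ} j<S = dec-run j j<S ⨟ adjust (underflows j)
  where
  adjust : ∀ b {j} → Run S (case D skip (pop D) (pop D ⨾ pop J))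
    (x ∷ k ∷ [] ∷ [] ∷ j ∷ mark b [] ∷ φ) (x ∷ k ∷ [] ∷ [] ∷ (if b then drop 1 j else j) ∷ [] ∷ φ)
  adjust true  = straight
  adjust false = straight

branch-∷ : ∀ c {w} {p q : Prog v} {σ τ} → Run S q σ τ → Run S (branch (c ∷ w) p q q) σ τ
branch-∷ true  r = r
branch-∷ false r = r

excess : ℕ → ℕ → Word → Word
excess zero    k       e = e
excess (suc m) zero    e = excess m zero (true ∷ e)
excess (suc m) (suc k) e = excess m k e

readInput : Program
readInput = case Y skip (pop Y ⨾ pop W) (pop Y ⨾ push A true ⨾ case J (push E true) predJ predJ)

readInput-iter : ∀ m k {j e a φ} → j ≡ binary k → length j < S →
  ∃[ j′ ] (length j′ < S × Iter S W readInput (suc m)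
  (x ∷ i ∷ [] ∷ [] ∷ j ∷ [] ∷ z ∷ t ∷ (true ∷ []) ∷ h ∷ g ∷ b ∷ (unary m ++ y) ∷ r ∷ f ∷ e ∷ a ∷ φ)
  (x ∷ i ∷ [] ∷ [] ∷ j′ ∷ [] ∷ z ∷ t ∷ [] ∷ h ∷ g ∷ b ∷ y ∷ r ∷ f
    ∷ excess m k e ∷ (replicate m true ʳ++ a) ∷ φ))
readInput-iter zero    k eq j<S = _ , j<S , next refl (split straight) (stop refl)
readInput-iter (suc m) zero refl j<S with j′ , j′<S , it ← readInput-iter m zero refl j<S =
  j′ , j′<S , next refl (split (straight ⨟ straight ⨟ split straight)) it
readInput-iter {S = S} (suc m) (suc k) eq j<S with binary-suc k
... | c , w , eq₁ , eq₂ with refl ← trans eq eq₁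
  with j′ , j′<S , it ← readInput-iter m k eq₂ (≤-<-trans (length-predecessor (c ∷ w)) j<S) =
  j′ , j′<S , next refl (split (straight ⨟ straight ⨟ split (branch-∷ c (predJ-run (c ∷ w) j<S)))) it

-- Output and assembly of the reduction

-- Without inputs the size bound and the balance condition hold for every `y`, so the answer does
-- not depend on the new parameter.
accepting : Circuit
accepting = circuit 0 AND (output [])

-- An OR gate that reads no wire is false, and the output gate reads it.
rejecting : Circuit
rejecting = circuit 0 OR (level ([] ∷ []) (output (true ∷ [])))

-- The words serve as flags: too many inputs, a success, a completed round. If none is raised, the
-- fuel ran out with the instance undecided.
decide : Circuit → Word → Word → Word → Circuit
decide C []      []      []      = C
decide C []      []      (_ ∷ _) = rejecting
decide C []      (_ ∷ _) d       = accepting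
decide C (_ ∷ _) r       d       = rejecting

pushAll : Fin 18 → Word → Program
pushAll x = List.foldr (λ b p → p ⨾ push x b) skip

write : Circuit → Program
write C = clear X ⨾ pushAll X (encode C)

writeAccepting-run : ∀ x {σ} → length x ≤ S → Run S (write accepting) (x ∷ σ) (encode accepting ∷ σ)
writeAccepting-run x {σ} x≤S =
  each-run (const skip) (λ x _ → x ∷ σ) refl (λ b → straight) x {[]} x≤S ⨟ straight

writeRejecting-run : ∀ x {σ} → length x ≤ S → Run S (write rejecting) (x ∷ σ) (encode rejecting ∷ σ)
writeRejecting-run x {σ} x≤S =
  each-run (const skip) (λ x _ → x ∷ σ) refl (λ b → straight) x {[]} x≤S ⨟ straight

answer : Program
answer = case R (case D skip (write rejecting) (write rejecting)) (write accepting) (write accepting)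

answer-run : ∀ C r d {k t h j z w i y g b u φ} → length (encode C) ≤ S →
  Run S answer (encode C ∷ k ∷ t ∷ h ∷ j ∷ d ∷ z ∷ w ∷ i ∷ y ∷ g ∷ b ∷ u ∷ r ∷ φ)
               (encode (decide C [] r d) ∷ k ∷ t ∷ h ∷ j ∷ d ∷ z ∷ w ∷ i ∷ y ∷ g ∷ b ∷ u ∷ r ∷ φ)
answer-run C []      []      C≤S = split (split straight)
answer-run C []      (c ∷ d) C≤S = split (split (branch-∷ c (writeRejecting-run (encode C) C≤S)))
answer-run C (c ∷ r) d       C≤S = split (branch-∷ c (writeAccepting-run (encode C) C≤S))

settle : Program
settle = case E (search ⨾ answer) (write rejecting) (write rejecting)

allTrue : ∀ m → Vec Bool m
allTrue m = Vec.replicate m true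

outcome : Circuit → ℕ → ℕ → Circuit
outcome C k fuel = decide C (excess (inputs C) k [])
  (hits (accepts (levels C)) fuel (allTrue (inputs C)) []) (wraps fuel (allTrue (inputs C)) [])

bodyCode : Circuit → Word
bodyCode C = encodeGate (firstGate C) ∷ encodeLevels (levels C)

length-encode : ∀ C → length (encode C) ≡ suc (inputs C) + length (bodyCode C)
length-encode C = trans (length-++ (unary (inputs C))) (cong (_+ length (bodyCode C)) (length-unary (inputs C)))

inputs<encode : ∀ C → inputs C < length (encode C)
inputs<encode C = ≤-trans (m≤m+n (suc (inputs C)) _) (≤-reflexive (sym (length-encode C)))

bodyCode≤encode : ∀ C → length (bodyCode C) ≤ length (encode C)
bodyCode≤encode C = ≤-trans (m≤n+m _ (suc (inputs C))) (≤-reflexive (sym (length-encode C)))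

settle-run : ∀ C e f {k φ} → length (encode C) ≤ S → inputs C + inputs C ≤ S → length f ≤ S →
  ∃[ σ ] Run S settle
    (encode C ∷ k ∷ [] ∷ [] ∷ toList (allTrue (inputs C)) ∷ [] ∷ [] ∷ [] ∷ [] ∷ [] ∷ [] ∷ []
      ∷ bodyCode C ∷ [] ∷ f ∷ e ∷ φ)
    (encode (decide C e (hits (accepts (levels C)) (length f) (allTrue (inputs C)) [])
                        (wraps (length f) (allTrue (inputs C)) [])) ∷ k ∷ σ)
settle-run C []      f C≤S m+m≤S f≤S =
  let j , searched = search-run (levels C) f (allTrue (inputs C)) (≤-trans (bodyCode≤encode C) C≤S) m+m≤S
                       (≤-trans (inputs<encode C) C≤S) f≤S
  in _ , split (searched ⨟ answer-run C _ _ C≤S)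
settle-run C (c ∷ e) f C≤S m+m≤S f≤S = _ , split (branch-∷ c (writeRejecting-run (encode C) C≤S))

-- Pushing a `true` onto a bijective binary numeral x gives 2 (1 + x), so the
-- length of k plus one of them multiply u k by at least k.
shift : Word → ℕᵇ → ℕᵇ
shift []      x = x
shift (_ ∷ w) x = 2[1+ shift w x ]

digits-shift : ∀ w x → digits (shift w x) ≡ List.map (const true) w ++ digits x
digits-shift []      x = refl
digits-shift (_ ∷ w) x = cong (true ∷_) (digits-shift w x)

parameter : (ℕ → ℕ) → ℕ → ℕ
parameter u k = ℕᵇ.toℕ 2[1+ shift (binary k) (fromℕ (u k)) ]

binary-parameter : ∀ u k → binary (parameter u k) ≡ true ∷ List.map (const true) (binary k) ++ binary (u k)
binary-parameter u k = trans (cong digits (fromℕ-toℕ 2[1+ shift (binary k) (fromℕ (u k)) ]))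
  (cong (true ∷_) (digits-shift (binary k) (fromℕ (u k))))

prepare : Program
prepare = pass K (λ b → push K b ⨾ push U b)

initial : Word → Word → Word → Store 18
initial x k u = x ∷ k ∷ [] ∷ [] ∷ [] ∷ [] ∷ [] ∷ [] ∷ [] ∷ [] ∷ [] ∷ [] ∷ [] ∷ [] ∷ [] ∷ [] ∷ [] ∷ u ∷ []

prepare-run : ∀ x k → length k ≤ S → Run S prepare (initial x k []) (initial x k k)
prepare-run x k k≤S = pass-run (λ b → push K b ⨾ push U b)
  (λ t z → x ∷ z ∷ t ∷ [] ∷ [] ∷ [] ∷ [] ∷ [] ∷ [] ∷ [] ∷ [] ∷ [] ∷ [] ∷ [] ∷ [] ∷ [] ∷ [] ∷ z ∷ [])
  refl (λ b → straight) refl (λ b → straight) k k≤S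

-- The fuel needs no arithmetic: both components of the candidate output are copied onto `F`, one
-- unit of fuel per bit. The parameter is assembled on `U` by pushing one `true` per digit of k, and
-- one more, on top of u(k).
main : Program
main =
  pass K (λ b → push J b ⨾ push U true) ⨾ push U true ⨾
  pass U (λ b → push K b ⨾ push F b) ⨾
  pass X (λ b → push X b ⨾ push Y b ⨾ push F b) ⨾
  push W true ⨾ while W readInput ⨾
  clear J ⨾ each A (push J) ⨾
  settle

main-run : ∀ C k u → let l = true ∷ List.map (const true) (binary k) ++ u in
  length (encode C) + length (encode C) + length l ≤ S →
  ∃[ σ ] Run S main (initial (encode C) (binary k) u)
                    (encode (outcome C k (length (encode C ++ l))) ∷ l ∷ σ)
main-run {S = S} C k u bounded =
  let j , j<S , it = readInput-iter {S = S} (inputs C) k {binary k} refl k<S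
      σ , settled = settle-run C (excess (inputs C) k []) (c ++ l) C≤S m+m≤S f≤S
  in σ , (pass-run (λ b → push J b ⨾ push U true)
      (λ t z → c ∷ [] ∷ t ∷ [] ∷ z ∷ [] ∷ [] ∷ [] ∷ [] ∷ [] ∷ [] ∷ [] ∷ [] ∷ [] ∷ [] ∷ [] ∷ []
        ∷ (List.map (const true) z ++ u) ∷ [])
      refl (λ b → straight) refl (λ b → straight) (binary k) (<⇒≤ k<S)
    ⨟ straight
    ⨟ pass-run (λ b → push K b ⨾ push F b)
      (λ t z → c ∷ z ∷ t ∷ [] ∷ binary k ∷ [] ∷ [] ∷ [] ∷ [] ∷ [] ∷ [] ∷ [] ∷ [] ∷ [] ∷ z ∷ [] ∷ [] ∷ [] ∷ [])
      refl (λ b → straight) refl (λ b → straight) l l≤S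
    ⨟ pass-run (λ b → push X b ⨾ push Y b ⨾ push F b)
      (λ t z → z ∷ l ∷ t ∷ [] ∷ binary k ∷ [] ∷ [] ∷ [] ∷ [] ∷ [] ∷ [] ∷ [] ∷ z ∷ [] ∷ (z ++ l)
        ∷ [] ∷ [] ∷ [] ∷ [])
      refl (λ b → straight) refl (λ b → straight) c C≤S
    ⨟ straight
    ⨟ loop (≤-trans (inputs<encode C) C≤S) it
    ⨟ each-run (const skip)
      (λ j _ → c ∷ l ∷ [] ∷ [] ∷ j ∷ [] ∷ [] ∷ [] ∷ [] ∷ [] ∷ [] ∷ [] ∷ bodyCode C ∷ [] ∷ (c ++ l)
        ∷ excess (inputs C) k [] ∷ reverse (replicate (inputs C) true) ∷ [] ∷ [])
      refl (λ b → straight) j {[]} (<⇒≤ j<S)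
    ⨟ subst (λ j → Run S (each A (push J)) (st (reverse (replicate (inputs C) true)) []) (st [] j))
        (trans (reverse-involutive (replicate (inputs C) true)) (sym (toList-replicate (inputs C) true)))
        (each-run (push J) st refl (λ b → straight) (reverse (replicate (inputs C) true))
          (≤-trans (≤-reflexive (trans (length-reverse (replicate (inputs C) true)) (length-replicate (inputs C))))
            (≤-trans (<⇒≤ (inputs<encode C)) C≤S)))
    ⨟ settled)
  where
  c = encode C
  l = true ∷ List.map (const true) (binary k) ++ u

  st : Word → Word → Store 18
  st a j = c ∷ l ∷ [] ∷ [] ∷ j ∷ [] ∷ [] ∷ [] ∷ [] ∷ [] ∷ [] ∷ [] ∷ bodyCode C ∷ [] ∷ (c ++ l)
    ∷ excess (inputs C) k [] ∷ a ∷ [] ∷ []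

  C≤S : length c ≤ S
  C≤S = ≤-trans (m≤m+n (length c) (length c)) (m+n≤o⇒m≤o (length c + length c) bounded)

  l≤S : length l ≤ S
  l≤S = m+n≤o⇒n≤o (length c + length c) bounded

  k<S : length (binary k) < S
  k<S = ≤-trans (s≤s (≤-trans (≤-reflexive (sym (length-map (const true) (binary k))))
    (≤-trans (m≤m+n _ (length u)) (≤-reflexive (sym (length-++ (List.map (const true) (binary k)))))))) l≤S

  m+m≤S : inputs C + inputs C ≤ S
  m+m≤S = ≤-trans (+-mono-≤ (<⇒≤ (inputs<encode C)) (<⇒≤ (inputs<encode C)))
    (m+n≤o⇒m≤o (length c + length c) bounded)

  f≤S : length (c ++ l) ≤ S
  f≤S = ≤-trans (≤-reflexive (length-++ c))
    (≤-trans (+-monoˡ-≤ (length l) (m≤m+n (length c) (length c))) bounded)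

-- Correctness of the search

bit : Bool → ℕ
bit true  = 1
bit false = 0

value : Vec Bool m → ℕ
value []      = 0
value (b ∷ a) = bit b + 2 * value a

value-injective : (a a′ : Vec Bool m) → value a ≡ value a′ → a ≡ a′
value-injective []          []           eq = refl
value-injective (true ∷ a)  (true ∷ a′)  eq =
  cong (true ∷_) (value-injective a a′ (*-cancelˡ-≡ _ _ 2 (suc-injective eq)))
value-injective (false ∷ a) (false ∷ a′) eq =
  cong (false ∷_) (value-injective a a′ (*-cancelˡ-≡ _ _ 2 eq))
value-injective (true ∷ a)  (false ∷ a′) eq = contradiction (sym eq) (even≢odd (value a′) (value a))
value-injective (false ∷ a) (true ∷ a′)  eq = contradiction eq (even≢odd (value a) (value a′))

value-previous : (a : Vec Bool m) → allFalse a ≡ false → value a ≡ suc (value (previous a))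
value-previous (true ∷ a)  eq = refl
value-previous (false ∷ a) eq =
  trans (cong (2 *_) (value-previous a eq)) (*-suc 2 (value (previous a)))

value-allFalse : (a : Vec Bool m) → allFalse a ≡ true → value a ≡ 0
value-allFalse []          eq = refl
value-allFalse (false ∷ a) eq = cong (2 *_) (value-allFalse a eq)

value-allTrue : ∀ m → suc (value (allTrue m)) ≡ 2 ^ m
value-allTrue zero    = refl
value-allTrue (suc m) = trans (sym (*-suc 2 (value (allTrue m)))) (cong (2 *_) (value-allTrue m))

value<2^ : (a : Vec Bool m) → value a < 2 ^ m
value<2^ []      = s≤s z≤n
value<2^ {suc m} (b ∷ a) = begin-strict
  bit b + 2 * value a   <⟨ +-monoˡ-< (2 * value a) (bit<2 b) ⟩
  2 + 2 * value a       ≡⟨ sym (*-suc 2 (value a)) ⟩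
  2 * suc (value a)     ≤⟨ *-monoʳ-≤ 2 (value<2^ a) ⟩
  2 * 2 ^ m             ∎
  where
  open ≤-Reasoning
  bit<2 : ∀ b → bit b < 2
  bit<2 true  = ≤-refl
  bit<2 false = s≤s z≤n

value≤allTrue : (a : Vec Bool m) → value a ≤ value (allTrue m)
value≤allTrue {m} a = s≤s⁻¹ (≤-trans (value<2^ a) (≤-reflexive (sym (value-allTrue m))))

hits-nonempty : ∀ (ok : Vec Bool m → Bool) n a {b r} → hits ok n a (b ∷ r) ≢ []
hits-nonempty ok zero    a ()
hits-nonempty ok (suc n) a eq with ok a
... | true  = hits-nonempty ok n (previous a) eq
... | false = hits-nonempty ok n (previous a) eq

wraps-nonempty : ∀ n (a : Vec Bool m) {b d} → wraps n a (b ∷ d) ≢ []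
wraps-nonempty zero    a ()
wraps-nonempty (suc n) a eq with allFalse a
... | true  = wraps-nonempty n (previous a) eq
... | false = wraps-nonempty n (previous a) eq

hits-sound : ∀ (ok : Vec Bool m → Bool) n a {b r} → hits ok n a [] ≡ b ∷ r → ∃[ a′ ] ok a′ ≡ true
hits-sound ok zero    a ()
hits-sound ok (suc n) a eq with ok a in ok≡
... | true  = a , ok≡
... | false = hits-sound ok n (previous a) eq

-- Values go down by one from `value a`, so a restart can only be recorded after every assignment of
-- smaller value has been tested.
hits-complete : ∀ (ok : Vec Bool m → Bool) n a {b d} → hits ok n a [] ≡ [] → wraps n a [] ≡ b ∷ d →
                ∀ a′ → value a′ ≤ value a → ok a′ ≡ false
hits-complete ok zero    a hit () a′ a′≤a
hits-complete ok (suc n) a hit wrap a′ a′≤a with ok a in ok≡ | allFalse a in last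
... | true  | _     = contradiction hit (hits-nonempty ok n (previous a))
-- The last assignment has value 0, so `a′` can only be `a`.
... | false | true  = trans (cong ok (value-injective a′ a
  (trans (n≤0⇒n≡0 (≤-trans a′≤a (≤-reflexive (value-allFalse a last)))) (sym (value-allFalse a last))))) ok≡
... | false | false with m≤n⇒m<n∨m≡n a′≤a
... | inj₁ a′<a = hits-complete ok n (previous a) hit wrap a′
  (s≤s⁻¹ (≤-trans a′<a (≤-reflexive (value-previous a last))))
... | inj₂ a′≡a = trans (cong ok (value-injective a′ a a′≡a)) ok≡

-- Without a restart each test lowers the value by one. The test of the value 0 itself records a
-- restart, so at most `value a` tests were made; from the all-true start this is fewer than 2 ^ m.
wraps-fuel : ∀ n (a : Vec Bool m) → wraps n a [] ≡ [] → n ≤ value a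
wraps-fuel zero    a eq = z≤n
wraps-fuel (suc n) a eq with allFalse a in last
... | true  = contradiction eq (wraps-nonempty n (previous a))
... | false = ≤-trans (s≤s (wraps-fuel n (previous a) eq)) (≤-reflexive (sym (value-previous a last)))

-- Balance of an assignment

-- As `m` counts the true and the false entries together, the equations say without subtraction that
-- their difference is `n`, respectively minus `n`.
Surplus Deficit : Vec Bool m → ℕ → Set
Surplus {m} a n = imbalance (toList a) ≡ replicate n true × 2 * ∣ a ∣ ≡ n + m
Deficit {m} a n = imbalance (toList a) ≡ replicate n false × n + 2 * ∣ a ∣ ≡ m

imbalance-counts : (a : Vec Bool m) → ∃[ n ] (Surplus a n ⊎ Deficit a n)
imbalance-counts [] = 0 , inj₁ (refl , refl)
imbalance-counts (true ∷ a) with imbalance-counts a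
... | zero , inj₁ (eq , c) rewrite eq = 1 , inj₁ (refl , trans (*-suc 2 ∣ a ∣) (cong (2 +_) c))
... | suc n , inj₁ (eq , c) rewrite eq =
  2 + n , inj₁ (refl , trans (*-suc 2 ∣ a ∣) (trans (cong (2 +_) c) (cong (2 +_) (sym (+-suc n _)))))
... | zero , inj₂ (eq , c) rewrite eq = 1 , inj₁ (refl , trans (*-suc 2 ∣ a ∣) (cong (2 +_) c))
... | suc n , inj₂ (eq , c) rewrite eq =
  n , inj₂ (refl , trans (cong (n +_) (*-suc 2 ∣ a ∣)) (trans (+-suc n _) (cong suc (trans (+-suc n _) c))))
imbalance-counts (false ∷ a) with imbalance-counts a
... | zero , inj₁ (eq , c) rewrite eq = 1 , inj₂ (refl , cong suc c)
... | suc n , inj₁ (eq , c) rewrite eq = n , inj₁ (refl , trans c (sym (+-suc n _)))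
... | zero , inj₂ (eq , c) rewrite eq = 1 , inj₂ (refl , cong suc c)
... | suc n , inj₂ (eq , c) rewrite eq = 2 + n , inj₂ (refl , cong suc c)

balanced⇔half : (a : Vec Bool m) → null (imbalance (toList a)) ≡ true ⇔ 2 * ∣ a ∣ ≡ m
balanced⇔half {m} a with imbalance-counts a
... | zero  , inj₁ (eq , c) rewrite eq = mk⇔ (λ _ → c) (λ _ → refl)
... | zero  , inj₂ (eq , c) rewrite eq = mk⇔ (λ _ → c) (λ _ → refl)
... | suc n , inj₁ (eq , c) rewrite eq = mk⇔ (λ ()) (λ h → contradiction (trans (sym h) c) (m≢1+n+m m {n}))
... | suc n , inj₂ (eq , c) rewrite eq =
  mk⇔ (λ ()) (λ h → contradiction (trans h (sym c)) (m≢1+n+m (2 * ∣ a ∣) {n}))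

HalfSatisfying : (C : Circuit) → Assignment (inputs C) → Set
HalfSatisfying C a = 2 * ∣ a ∣ ≡ inputs C × eval C a ≡ true

open Equivalence using (to; from)

accepts⇔ : ∀ C a → accepts (levels C) a ≡ true ⇔ HalfSatisfying C a
accepts⇔ C a = mk⇔ sound complete
  where
  sound : accepts (levels C) a ≡ true → HalfSatisfying C a
  sound eq with null (imbalance (toList a)) in bal
  ... | true = to (balanced⇔half a) bal , eq

  complete : HalfSatisfying C a → accepts (levels C) a ≡ true
  complete (half , sat) rewrite from (balanced⇔half a) half = sat

excess-nonempty : ∀ m k {b e} → excess m k (b ∷ e) ≢ []
excess-nonempty zero    k       ()
excess-nonempty (suc m) zero    = excess-nonempty m zero
excess-nonempty (suc m) (suc k) = excess-nonempty m k

excess-[]⇒≤ : ∀ m k {e} → excess m k e ≡ [] → m ≤ k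
excess-[]⇒≤ zero    k       eq = z≤n
excess-[]⇒≤ (suc m) zero    eq = contradiction eq (excess-nonempty m zero)
excess-[]⇒≤ (suc m) (suc k) eq = s≤s (excess-[]⇒≤ m k eq)

≤⇒excess≡ : ∀ {m k} {e} → m ≤ k → excess m k e ≡ e
≤⇒excess≡ z≤n     = refl
≤⇒excess≡ (s≤s p) = ≤⇒excess≡ p

-- Equivalence of input and output

ι-cancel-≤ : ι m ≤ℝ ι n → m ≤ n
ι-cancel-≤ {m} {n} le = ≤-trans (le {m} {1} (≤-reflexive (sym (+-identityʳ m)))) (≤-reflexive (+-identityʳ n))

ι-mono-≤ : m ≤ n → ι m ≤ℝ ι n
ι-mono-≤ m≤n {a} {b} a≤ = ≤-trans a≤ (*-monoʳ-≤ b m≤n)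

P-accepting : ∀ y → P-HwSAT accepting y
P-accepting y =
  (λ {a} {b} a≤ → subst (λ a → below y a b)
    (sym (n≤0⇒n≡0 (≤-trans a≤ (≤-reflexive (*-zeroʳ b))))) (nonneg y b))
  , [] , refl , refl

-- `y` is a function of the circuit because the new bound depends on the size of the output. The
-- premise is called upon only when the search is undecided; the fixed circuits satisfy or fail the
-- predicate for every bound.
outcome-correct : ∀ C k fuel (y : Circuit → ℝ≥0) →
  (inputs C ≤ k → fuel < 2 ^ inputs C → ι (inputs C) ≤ℝ y C) →
  P-HwSAT C (ι k) ⇔ P-HwSAT (outcome C k fuel) (y (outcome C k fuel))
outcome-correct C k fuel y fits
  with excess (inputs C) k [] in excess≡
     | hits (accepts (levels C)) fuel (allTrue (inputs C)) [] in hits≡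
     | wraps fuel (allTrue (inputs C)) [] in wraps≡
... | _ ∷ _ | _ | _ = mk⇔
  (λ (m≤k , _) → contradiction
    (trans (sym excess≡) (≤⇒excess≡ (ι-cancel-≤ {inputs C} {k} λ {a} {b} → m≤k {a} {b}))) λ ())
  (λ { (_ , [] , _ , ()) })
... | [] | _ ∷ _ | _ = mk⇔ (λ _ → P-accepting (y accepting))
  (λ _ → let a , ok = hits-sound _ fuel _ hits≡
         in (λ {a} {b} → ι-mono-≤ (excess-[]⇒≤ (inputs C) k excess≡) {a} {b}) , a , to (accepts⇔ C a) ok)
... | [] | [] | _ ∷ _ = mk⇔
  (λ (_ , a , good) → contradiction
    (trans (sym (from (accepts⇔ C a) good)) (hits-complete _ fuel _ hits≡ wraps≡ a (value≤allTrue a))) λ ())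
  (λ { (_ , [] , _ , ()) })
... | [] | [] | [] = mk⇔
  (λ (_ , good) → (λ {a} {b} → fits (excess-[]⇒≤ (inputs C) k excess≡)
    (≤-trans (s≤s (wraps-fuel fuel _ wraps≡)) (≤-reflexive (value-allTrue (inputs C)))) {a} {b}) , good)
  -- The bound m ≤ k is recovered from the comparison made by the program, not from the new bound.
  (λ (_ , good) → (λ {a} {b} → ι-mono-≤ (excess-[]⇒≤ (inputs C) k excess≡) {a} {b}) , good)

-- Growth of the new parameter

-- The largest bijective numeral with d digits consists of twos and denotes 2 ^ (d + 1) - 2; the
-- summand 2 makes the induction go through.
toℕ-digits : ∀ x → 2 + ℕᵇ.toℕ x ≤ 2 ^ suc (length (digits x))
toℕ-digits zero     = ≤-refl
toℕ-digits 2[1+ x ] = ≤-trans (≤-reflexive (sym (*-suc 2 (suc (ℕᵇ.toℕ x))))) (*-monoʳ-≤ 2 (toℕ-digits x))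
toℕ-digits 1+[2 x ] = ≤-trans (s≤s (≤-trans (≤-reflexive (sym (*-suc 2 (ℕᵇ.toℕ x)))) (n≤1+n _)))
  (≤-trans (≤-reflexive (sym (*-suc 2 (suc (ℕᵇ.toℕ x))))) (*-monoʳ-≤ 2 (toℕ-digits x)))

toℕ-shift : ∀ w x → 2 ^ length w * ℕᵇ.toℕ x ≤ ℕᵇ.toℕ (shift w x)
toℕ-shift []      x = ≤-reflexive (*-identityˡ _)
toℕ-shift (_ ∷ w) x = ≤-trans (≤-reflexive (*-assoc 2 (2 ^ length w) _))
  (*-monoʳ-≤ 2 (≤-trans (toℕ-shift w x) (n≤1+n _)))

parameter-≥ : ∀ u k → k * u k ≤ parameter u k
parameter-≥ u k = begin
  k * u k                          ≤⟨ *-monoˡ-≤ (u k) k≤ ⟩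
  2 ^ suc (length (binary k)) * u k ≡⟨ cong (2 ^ suc (length (binary k)) *_) (sym (toℕ-fromℕ (u k))) ⟩
  2 ^ suc (length (binary k)) * ℕᵇ.toℕ (fromℕ (u k)) ≤⟨ toℕ-shift (true ∷ binary k) (fromℕ (u k)) ⟩
  parameter u k                    ∎
  where
  open ≤-Reasoning
  k≤ : k ≤ 2 ^ suc (length (binary k))
  k≤ = ≤-trans (≤-trans (≤-reflexive (sym (toℕ-fromℕ k))) (m≤n+m _ 2)) (toℕ-digits (fromℕ k))

-- With the quotient unfolded, each fraction p / q ≤ t(n) asks for a comparison of a power of 2 with
-- a power of n. The logarithm enters only through 2 ≤ n, that is log n ≥ 1; the rest compares
-- exponents.
fits-parameter : (t : ℕ → ℝ>0) → NonDecreasing (real ∘ t) → (u : ℕ → ℕ) →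
  (∀ k → real (t (2 ^ k)) ≤ℝ ι (u k)) →
  ∀ m k n .{{_ : NonZero n}} → m ≤ k → 2 ≤ n → n ≤ 2 ^ m → ι m ≤ℝ parameter u k · s[ t ] n
fits-parameter t t↗ u t≤u m k n m≤k 2≤n n≤2^m {a} {b} a≤bm {p} {q} p≤tq = begin
  2 ^ (a * p)          ≤⟨ ^-monoˡ-≤ (a * p) 2≤n ⟩
  n ^ (a * p)          ≤⟨ ^-monoʳ-≤ n exponent ⟩
  n ^ (b * parameter u k * q) ∎
  where
  open ≤-Reasoning
  open +-*-Solver
  p≤qu : p ≤ q * u k
  p≤qu = t≤u k (t↗ (≤-trans n≤2^m (^-monoʳ-≤ 2 m≤k)) p≤tq)

  exponent : a * p ≤ b * parameter u k * q
  exponent = begin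
    a * p                    ≤⟨ *-mono-≤ (≤-trans a≤bm (*-monoʳ-≤ b m≤k)) p≤qu ⟩
    b * k * (q * u k)
      ≡⟨ solve 4 (λ b k q u → b :* k :* (q :* u) := b :* (k :* u) :* q) refl b k q (u k) ⟩
    b * (k * u k) * q        ≤⟨ *-monoˡ-≤ q (*-monoʳ-≤ b (parameter-≥ u k)) ⟩
    b * parameter u k * q    ∎

-- The fuel of the search is one less than the size of the output ⟨C, l(k)⟩.
reduction : (ℕ → ℕ) → Instance → Instance
reduction u (C , k) = outcome C k (length (encode C ++ binary (parameter u k))) , parameter u k

size-fuel : ∀ C k → suc (length (encode C ++ binary k)) ≡ size (C , k)
size-fuel C k = cong suc (length-++ (encode C))

2≤size : ∀ C k → 2 ≤ size (C , k)
2≤size C k = s≤s (≤-trans (≤-trans (s≤s z≤n) (inputs<encode C)) (m≤m+n _ _))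

-- Running time

Is-o-* : ∀ {g} M → Is-o g → Is-o (λ k → g k * M)
Is-o-* {g} M small c with k₀ , h ← small (c * M) = k₀ , λ k k₀≤k →
  ≤-trans (≤-reflexive (trans (cong (c *_) (*-comm (g k) M)) (sym (*-assoc c M (g k))))) (h k k₀≤k)

-- Here `c`, `b` and `v` are the lengths of the codes of C, k and u(k), and `q` is 2 ^ g(k). With n
-- the size of the instance, the sum is at most 5 n q. It is padded to 8 n q, and 8 ≤ n ^ 3 since n
-- ≥ 2, which gives the fourth power.
budget : ∀ c b v q → 1 ≤ c → 1 ≤ q → v ≤ b + q →
         2 + (c + c + suc (b + v) + q) ≤ suc (c + b) ^ 4 * q
budget c b v q 1≤c 1≤q v≤ = begin
  2 + (c + c + suc (b + v) + q)
    ≤⟨ +-monoʳ-≤ 2 (+-monoˡ-≤ q (+-monoʳ-≤ (c + c) (s≤s (+-monoʳ-≤ b v≤)))) ⟩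
  2 + (c + c + suc (b + (b + q)) + q)
    ≡⟨ solve 3 (λ c b q → con 2 :+ (c :+ c :+ (con 1 :+ (b :+ (b :+ q))) :+ q)
                  := con 2 :* (con 1 :+ (c :+ b)) :+ con 1 :+ con 2 :* q) refl c b q ⟩
  2 * size′ + 1 + 2 * q                    ≤⟨ +-mono-≤ (+-mono-≤ (*-monoʳ-≤ 2 n≤nq) 1≤nq) (*-monoʳ-≤ 2 q≤nq) ⟩
  2 * (size′ * q) + size′ * q + 2 * (size′ * q)    ≤⟨ m≤m+n _ (3 * (size′ * q)) ⟩
  2 * (size′ * q) + size′ * q + 2 * (size′ * q) + 3 * (size′ * q)
    ≡⟨ solve 1 (λ y → con 2 :* y :+ y :+ con 2 :* y :+ con 3 :* y := con 8 :* y) refl (size′ * q) ⟩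
  8 * (size′ * q)                          ≤⟨ *-monoˡ-≤ (size′ * q) (^-monoˡ-≤ 3 2≤n) ⟩
  size′ ^ 3 * (size′ * q)
    ≡⟨ solve 2 (λ n q → n :^ 3 :* (n :* q) := n :^ 4 :* q) refl size′ q ⟩
  size′ ^ 4 * q                            ∎
  where
  open ≤-Reasoning
  open +-*-Solver
  size′ = suc (c + b)
  2≤n : 2 ≤ size′
  2≤n = s≤s (≤-trans 1≤c (m≤m+n c b))
  n≤nq : size′ ≤ size′ * q
  n≤nq = m≤m*n size′ q {{>-nonZero 1≤q}}
  1≤nq : 1 ≤ size′ * q
  1≤nq = ≤-trans (s≤s z≤n) n≤nq
  q≤nq : q ≤ size′ * q
  q≤nq = m≤n*m q size′

^-distribʳ-* : ∀ e m n → (m * n) ^ e ≡ m ^ e * n ^ e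
^-distribʳ-* zero    m n = refl
^-distribʳ-* (suc e) m n rewrite ^-distribʳ-* e m n = [m*n]*[o*p]≡[m*o]*[n*p] m n (m ^ e) (n ^ e)

main-run′ : ∀ u C k {S} →
  length (encode C) + length (encode C) + suc (length (binary k) + length (binary (u k))) ≤ S →
  ∃[ σ ] Run S main (initial (encode C) (binary k) (binary (u k)))
                    (encodeInstance (reduction u (C , k)) Vec.++ σ)
main-run′ u C k {S} bounded rewrite binary-parameter u k = main-run C k (binary (u k)) (begin
  c + length (true ∷ List.map (const true) (binary k) ++ binary (u k))
    ≡⟨ cong (λ n → c + suc n) (length-++ (List.map (const true) (binary k))) ⟩
  c + suc (length (List.map (const true) (binary k)) + length (binary (u k)))
    ≡⟨ cong (λ n → c + suc (n + length (binary (u k)))) (length-map (const true) (binary k)) ⟩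
  c + suc (length (binary k) + length (binary (u k)))
    ≤⟨ bounded ⟩
  S ∎)
  where
  open ≤-Reasoning
  c = length (encode C) + length (encode C)

-- Abstracting from the programs keeps their degrees from being unfolded.
compose-time : ∀ u (f : Instance → Instance) (first last : Program) →
  (∀ {S} x k → length k ≤ S → Run S first (initial x k []) (initial x k k)) →
  (∀ C k {S} → length (encode C) + length (encode C) + suc (length (binary k) + length (binary (u k))) ≤ S →
    ∃[ σ ] Run S last (initial (encode C) (binary k) (binary (u k))) (encodeInstance (f (C , k)) Vec.++ σ)) →
  ComputableIn2^o u → ReductionTime f
compose-time u f first last first-run last-run (w , p , g , small , computes) =
  -- `U` is the last of the 18 stacks, so together with the `w` additional ones it forms the store
  -- of `p`, which starts after the other 17.
  16 + w , rename (_↑ˡ w) first ⨾ rename (17 ↑ʳ_) p ⨾ rename (_↑ˡ w) last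
  , (λ k → g k * M) , 4 * M , Is-o-* M small , timed
  where
  -- `p` enters with exponent 1 whatever its loops are: its cost is at most 2 ^ g(k), which is a
  -- summand of `L`.
  M = suc (degree first + suc (1 + degree last))

  timed : ∀ C k → (rename (_↑ˡ w) first ⨾ rename (17 ↑ʳ_) p ⨾ rename (_↑ˡ w) last)
            maps encodeInstance (C , k) to encodeInstance (f (C , k))
            within 2 ^ (g k * M) * size (C , k) ^ (4 * M)
  timed C k =
    let c , zs , c≤ , d = computes k
        run {c₁} c₁≤ d₁ = first-run {L} (encode C) (binary k) k≤L
        σ , run {c₂} c₂≤ d₂ = last-run C k {L} (m≤m+n _ _)
    in c₁ + (c + c₂) , σ Vec.++ zs
     , total c₁≤ (≤-trans c≤ 2^g≤) c₂≤ (≤-trans (length-lookup-≤ d zero) (+-monoʳ-≤ K₁ c≤))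
     , seq (rename-↑ˡ _ d₁) (seq
         (rename-↑ʳ (Vec.take 17 (initial (encode C) (binary k) [])) d) (rename-↑ˡ zs d₂))
    where
    X₂ = length (encode C) + length (encode C)
    K₁ = length (binary k)
    U₁ = length (binary (u k))
    L  = X₂ + suc (K₁ + U₁) + 2 ^ g k

    k≤L : K₁ ≤ L
    k≤L = ≤-trans (≤-trans (m≤m+n K₁ U₁) (n≤1+n _)) (≤-trans (m≤n+m _ X₂) (m≤m+n _ _))

    2^g≤ : 2 ^ g k ≤ (2 + L) ^ 1
    2^g≤ = ≤-trans (m≤n+m (2 ^ g k) (2 + (X₂ + suc (K₁ + U₁)))) (≤-reflexive (sym (*-identityʳ _)))

    total : ∀ {c₁ c c₂} → c₁ ≤ bound L first → c ≤ (2 + L) ^ 1 → c₂ ≤ bound L last → U₁ ≤ K₁ + 2 ^ g k →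
            c₁ + (c + c₂) ≤ 2 ^ (g k * M) * size (C , k) ^ (4 * M)
    total {c₁} {c} {c₂} c₁≤ c≤ c₂≤ U₁≤ = begin
      c₁ + (c + c₂)
        ≤⟨ sum-≤-^ (2 + L) (degree first) (suc (1 + degree last)) 2≤2+L (≤-trans c₁≤ (bound-≤-^ L first))
             (sum-≤-^ (2 + L) 1 (degree last) 2≤2+L c≤ (≤-trans c₂≤ (bound-≤-^ L last))) ⟩
      (2 + L) ^ M
        ≤⟨ ^-monoˡ-≤ M (budget (length (encode C)) K₁ U₁ (2 ^ g k)
             (≤-trans (s≤s z≤n) (inputs<encode C)) (m^n>0 2 (g k)) U₁≤) ⟩
      (size (C , k) ^ 4 * 2 ^ g k) ^ M
        ≡⟨ ^-distribʳ-* M (size (C , k) ^ 4) (2 ^ g k) ⟩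
      (size (C , k) ^ 4) ^ M * (2 ^ g k) ^ M
        ≡⟨ cong₂ _*_ (^-*-assoc (size (C , k)) 4 M) (^-*-assoc 2 (g k) M) ⟩
      size (C , k) ^ (4 * M) * 2 ^ (g k * M)
        ≡⟨ *-comm (size (C , k) ^ (4 * M)) (2 ^ (g k * M)) ⟩
      2 ^ (g k * M) * size (C , k) ^ (4 * M) ∎
      where
      open ≤-Reasoning
      2≤2+L : 2 ≤ 2 + L
      2≤2+L = s≤s (s≤s z≤n)

reductionTime : ∀ u → ComputableIn2^o u → ReductionTime (reduction u)
reductionTime u = compose-time u (reduction u) prepare main prepare-run (main-run′ u)

lemma1 : (t : ℕ → ℝ>0) → NonDecreasing (real ∘ t) → Is-ω1 (real ∘ t) → Constructible (real ∘ t) →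
    Σ[ f ∈ (Instance → Instance) ] Σ[ l ∈ (ℕ → ℕ) ] Σ[ r ∈ (ℕ → ℕ) ]
    ( Is-ω1 (ι ∘ r)
    × (∀ k → r k · real (t (2 ^ k)) ≤ℝ ι (l k))
    × (∀ C k → ∃[ C₁ ]
    ( f (C , k) ≡ (C₁ , l k)
    × (P-HwSAT C (ι k) ⇔ P-HwSAT C₁ (l k · s[ t ] (size (C₁ , l k))))))
    × ReductionTime f )
lemma1 t t↗ _ (u , computable , t≤u) =
  reduction u , parameter u , (λ k → k)
  , (λ c → c , λ n c≤n {a} {b} → ι-mono-≤ c≤n {a} {b})
  , (λ k {a} {b} below-t → ≤-trans (t≤u k below-t)
      (≤-trans (≤-reflexive (*-assoc b k (u k))) (*-monoʳ-≤ b (parameter-≥ u k))))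
  , (λ C k → _ , refl , outcome-correct C k (length (encode C ++ binary (parameter u k)))
      (λ C₁ → parameter u k · s[ t ] (size (C₁ , parameter u k)))
      (λ m≤k fuel<2^m {a} {b} → fits-parameter t t↗ u t≤u (inputs C) k (size (C , parameter u k)) m≤k
        (2≤size C (parameter u k)) (≤-trans (≤-reflexive (sym (size-fuel C (parameter u k)))) fuel<2^m)
        {a} {b}))
  , reductionTime u computable
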